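{- $\operatorname{Slice}_{\omega_1}$ implies $\lnot\operatorname{MA}_{\omega_1}(\sigma\text{ -centred})$.
   Context: $\operatorname{Slice}_{\omega_1}$ is the statement that there exists a sequence $\{M_\alpha \mid \alpha<\omega_1\}$ of transitive classes (not necessarily proper classes) such that: (i) each $M_\alpha$ is a model of ZFC; (ii) $\omega_1^{M_\alpha}=\omega_1$ for every $\alpha$; (iii) $2^{\omega}=\bigcup_{\alpha<\omega_1}(2^{\omega}\cap M_\alpha)$; (iv) for all $\alpha<\beta<\omega_1$, $2^{\omega}\cap M_\alpha\subsetneq 2^{\omega}\cap M_\beta$. $\operatorname{MA}_{\omega_1}(\sigma\text{ -centred})$ is the statement: for every $\sigma$-centred partial order $\mathbb{P}$ and every family of $\omega_1$ many dense subsets of $\mathbb{P}$, there is a filter on $\mathbb{P}$ meeting all of them. -}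

module Defs where

open import Level using (Level; suc)
open import Data.Nat.Base as ℕ using (ℕ)
open import Data.Fin.Base using (Fin)
open import Data.Vec.Base using (Vec; _∷_; lookup)
open import Data.Vec.Relation.Unary.All using (All)
open import Data.Product.Base using (_×_; ∃)
open import Data.Sum.Base using (_⊎_)
open import Data.Unit.Polymorphic.Base using (⊤)
open import Function.Bundles using (_⇔_)
open import Relation.Nullary.Negation.Core using (¬_)
open import Relation.Binary.PropositionalEquality.Core using (_≡_)

private variable
  n : ℕ

-- First-order formulas over the signature {∈}, with n free variables
-- given as de Bruijn indices.

infix  9 _∊_ _≐_
infixr 8 _∧′_
infixr 7 _∨′_
infixr 6 _⇒′_
infix  5 _⇔′_

data Formula : ℕ → Set where
  _∊_ _≐_               : Fin n → Fin n → Formula n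
  ¬′_                   : Formula n → Formula n
  _∧′_ _∨′_ _⇒′_ _⇔′_   : Formula n → Formula n → Formula n
  ∀′_ ∃′_               : Formula (ℕ.suc n) → Formula n

record Structure (ℓ : Level) : Set (suc ℓ) where
  infix 4 _∈_
  field
    Carrier : Set ℓ
    _∈_     : Carrier → Carrier → Set ℓ

module SetTheory {ℓ : Level} (𝓥 : Structure ℓ) where

  open Structure 𝓥 renaming (Carrier to V)

  Class : Set (suc ℓ)
  Class = V → Set ℓ

  Universe : Class
  Universe _ = ⊤

  -- Everything in this module is relativised to the class M: all
  -- quantifiers range over M only.  Taking M = Universe gives the notions
  -- of the ambient universe.

  module Within (M : Class) where

    infix 2 Every Some

    Every Some : (V → Set ℓ) → Set ℓ
    Every P = ∀ x → M x → P x
    Some  P = ∃ λ x → M x × P x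

    syntax Every (λ x → P) = ∀ᴹ[ x ] P
    syntax Some  (λ x → P) = ∃ᴹ[ x ] P

    Sat : Formula n → Vec V n → Set ℓ
    Sat (i ∊ j)  ρ = lookup ρ i ∈ lookup ρ j
    Sat (i ≐ j)  ρ = lookup ρ i ≡ lookup ρ j
    Sat (¬′ φ)   ρ = ¬ Sat φ ρ
    Sat (φ ∧′ ψ) ρ = Sat φ ρ × Sat ψ ρ
    Sat (φ ∨′ ψ) ρ = Sat φ ρ ⊎ Sat ψ ρ
    Sat (φ ⇒′ ψ) ρ = Sat φ ρ → Sat ψ ρ
    Sat (φ ⇔′ ψ) ρ = Sat φ ρ ⇔ Sat ψ ρ
    Sat (∀′ φ)   ρ = ∀ᴹ[ x ] Sat φ (x ∷ ρ)
    Sat (∃′ φ)   ρ = ∃ᴹ[ x ] Sat φ (x ∷ ρ)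

    infix 4 _⊆_

    _⊆_ : V → V → Set ℓ
    x ⊆ y = ∀ᴹ[ z ] (z ∈ x → z ∈ y)

    Empty : V → Set ℓ
    Empty x = ∀ᴹ[ y ] (¬ y ∈ x)

    Nonempty : V → Set ℓ
    Nonempty x = ∃ᴹ[ y ] (y ∈ x)

    -- s = x ∪ {x}
    IsSuccessor : V → V → Set ℓ
    IsSuccessor s x = ∀ᴹ[ w ] (w ∈ s ⇔ (w ∈ x ⊎ w ≡ x))

    -- z = {x, y}
    IsPair : V → V → V → Set ℓ
    IsPair z x y = ∀ᴹ[ w ] (w ∈ z ⇔ (w ≡ x ⊎ w ≡ y))

    -- z = (x, y) = {{x}, {x, y}}
    IsOrderedPair : V → V → V → Set ℓ
    IsOrderedPair z x y =
      ∃ᴹ[ u ] (∃ᴹ[ v ] (IsPair u x x × IsPair v x y × IsPair z u v))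

    -- (x, y) ∈ r; for a function r this says r(x) = y.
    Related : V → V → V → Set ℓ
    Related r x y = ∃ᴹ[ z ] (z ∈ r × IsOrderedPair z x y)

    -- r ⊆ a × b
    IsRelation : V → V → V → Set ℓ
    IsRelation r a b =
      ∀ᴹ[ z ] (z ∈ r →
        ∃ᴹ[ x ] (∃ᴹ[ y ] (x ∈ a × y ∈ b × IsOrderedPair z x y)))

    record IsZFC : Set ℓ where
      field
        extensionality : ∀ᴹ[ x ] (∀ᴹ[ y ] ((∀ᴹ[ z ] (z ∈ x ⇔ z ∈ y)) → x ≡ y))
        foundation     : ∀ᴹ[ x ] (Nonempty x →
                           ∃ᴹ[ y ] (y ∈ x × ¬ (∃ᴹ[ z ] (z ∈ y × z ∈ x))))
        pairing        : ∀ᴹ[ x ] (∀ᴹ[ y ] (∃ᴹ[ z ] IsPair z x y))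
        union          : ∀ᴹ[ x ] (∃ᴹ[ u ] (∀ᴹ[ w ]
                           (w ∈ u ⇔ (∃ᴹ[ y ] (y ∈ x × w ∈ y)))))
        powerset       : ∀ᴹ[ x ] (∃ᴹ[ p ] (∀ᴹ[ w ] (w ∈ p ⇔ w ⊆ x)))
        infinity       : ∃ᴹ[ i ] ((∃ᴹ[ e ] (e ∈ i × Empty e)) ×
                           (∀ᴹ[ x ] (x ∈ i → ∃ᴹ[ s ] (s ∈ i × IsSuccessor s x))))
        separation     : ∀ {n} (φ : Formula (1 ℕ.+ n)) (ρ : Vec V n) → All M ρ →
                         ∀ᴹ[ a ] (∃ᴹ[ b ] (∀ᴹ[ x ]
                           (x ∈ b ⇔ (x ∈ a × Sat φ (x ∷ ρ)))))
        replacement    : ∀ {n} (φ : Formula (2 ℕ.+ n)) (ρ : Vec V n) → All M ρ →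
                         ∀ᴹ[ a ] (
                           (∀ᴹ[ x ] (x ∈ a → ∀ᴹ[ y ] (∀ᴹ[ y′ ]
                             (Sat φ (x ∷ y ∷ ρ) → Sat φ (x ∷ y′ ∷ ρ) → y ≡ y′)))) →
                           ∃ᴹ[ b ] (∀ᴹ[ y ]
                             (y ∈ b ⇔ (∃ᴹ[ x ] (x ∈ a × Sat φ (x ∷ y ∷ ρ))))))
        choice         : ∀ᴹ[ x ] (
                           (∀ᴹ[ y ] (y ∈ x → Nonempty y)) →
                           (∀ᴹ[ y ] (∀ᴹ[ y′ ] (y ∈ x → y′ ∈ x →
                             (∃ᴹ[ z ] (z ∈ y × z ∈ y′)) → y ≡ y′))) →
                           ∃ᴹ[ c ] (∀ᴹ[ y ] (y ∈ x →
                             ∃ᴹ[ z ] ((z ∈ y × z ∈ c) ×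
                               (∀ᴹ[ w ] (w ∈ y → w ∈ c → w ≡ z))))))

    IsFunction : V → V → V → Set ℓ
    IsFunction f a b =
      IsRelation f a b ×
      (∀ᴹ[ x ] (x ∈ a → ∃ᴹ[ y ] Related f x y)) ×
      (∀ᴹ[ x ] (∀ᴹ[ y ] (∀ᴹ[ y′ ] (Related f x y → Related f x y′ → y ≡ y′))))

    IsInjection : V → V → V → Set ℓ
    IsInjection f a b =
      IsFunction f a b ×
      (∀ᴹ[ x ] (∀ᴹ[ x′ ] (∀ᴹ[ y ] (Related f x y → Related f x′ y → x ≡ x′))))

    IsTransitive : V → Set ℓ
    IsTransitive x = ∀ᴹ[ y ] (y ∈ x → y ⊆ x)

    -- In the presence of foundation, the ordinals are exactly the transitive
    -- sets of transitive sets.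
    IsOrdinal : V → Set ℓ
    IsOrdinal x = IsTransitive x × (∀ᴹ[ y ] (y ∈ x → IsTransitive y))

    IsLimit : V → Set ℓ
    IsLimit x = IsOrdinal x × Nonempty x ×
      (∀ᴹ[ y ] (y ∈ x → ∃ᴹ[ s ] (s ∈ x × IsSuccessor s y)))

    IsOmega : V → Set ℓ
    IsOmega w = IsLimit w × (∀ᴹ[ y ] (y ∈ w → ¬ IsLimit y))

    Finite : V → Set ℓ
    Finite x = ∃ᴹ[ w ] (IsOmega w ×
      (∃ᴹ[ k ] (k ∈ w × (∃ᴹ[ f ] IsInjection f x k))))

    Countable : V → Set ℓ
    Countable x = ∃ᴹ[ w ] (IsOmega w × (∃ᴹ[ f ] IsInjection f x w))

    IsOmega₁ : V → Set ℓ
    IsOmega₁ w = IsOrdinal w × ¬ Countable w × (∀ᴹ[ y ] (y ∈ w → Countable y))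

    IsTwo : V → Set ℓ
    IsTwo t = ∃ᴹ[ e ] (∃ᴹ[ s ] (Empty e × IsSuccessor s e × IsSuccessor t s))

    -- x ∈ 2^ω
    IsReal : V → Set ℓ
    IsReal x = ∃ᴹ[ w ] (∃ᴹ[ t ] (IsOmega w × IsTwo t × IsFunction x w t))

  open Within Universe

  -- As usual over ZFC, classes are given by formulas with parameters; the
  -- sequence is uniformly definable, M α = { x | φ(α, x, params) }.  That
  -- M α is a model of ZFC means that all axioms relativised to it hold.
  record Slice : Set ℓ where
    field
      {#params} : ℕ
      φ         : Formula (2 ℕ.+ #params)
      params    : Vec V #params
      ω₁        : V
      isOmega₁  : IsOmega₁ ω₁

    M : V → Class
    M α x = Sat φ (α ∷ x ∷ params)

    field
      transitive : ∀ α → α ∈ ω₁ → ∀ x y → M α x → y ∈ x → M α y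
      zfc        : ∀ α → α ∈ ω₁ → Within.IsZFC (M α)
      ω₁-correct : ∀ α → α ∈ ω₁ → M α ω₁ × Within.IsOmega₁ (M α) ω₁
      covers     : ∀ x → IsReal x → ∃ λ α → α ∈ ω₁ × M α x
      increasing : ∀ α β → α ∈ β → β ∈ ω₁ → ∀ x → IsReal x → M α x → M β x
      strict     : ∀ α β → α ∈ β → β ∈ ω₁ → ∃ λ x → IsReal x × M β x × ¬ M α x

  -- Related R p q is p ≤ q, i.e. p is the stronger condition.

  record IsPartialOrder (P R : V) : Set ℓ where
    field
      nonempty : Nonempty P
      relation : IsRelation R P P
      reflexive : ∀ p → p ∈ P → Related R p p
      antisymmetric : ∀ p q → Related R p q → Related R q p → p ≡ q
      transitive : ∀ p q r → Related R p q → Related R q r → Related R p r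

  IsCentred : (P R A : V) → Set ℓ
  IsCentred P R A = A ⊆ P ×
    (∀ F → F ⊆ A → Finite F → ∃ λ q → q ∈ P × (∀ p → p ∈ F → Related R q p))

  -- P is the union of the centred sets c(n), n ∈ ω.
  IsσCentred : (P R : V) → Set ℓ
  IsσCentred P R = ∃ λ ω → ∃ λ 𝒞 → ∃ λ c →
    IsOmega ω × IsFunction c ω 𝒞 ×
    (∀ n A → Related c n A → IsCentred P R A) ×
    (∀ p → p ∈ P → ∃ λ n → ∃ λ A → Related c n A × p ∈ A)

  IsDense : (P R D : V) → Set ℓ
  IsDense P R D = D ⊆ P × (∀ p → p ∈ P → ∃ λ q → q ∈ D × Related R q p)

  record IsFilter (P R G : V) : Set ℓ where
    field
      subset   : G ⊆ P
      nonempty : Nonempty G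
      upward   : ∀ p q → p ∈ G → Related R p q → q ∈ G
      directed : ∀ p q → p ∈ G → q ∈ G →
                 ∃ λ r → r ∈ G × Related R r p × Related R r q

  -- The family of dense sets is indexed by ω₁, as a function d : ω₁ → 𝒟.
  MA-ω₁-σ-centred : Set ℓ
  MA-ω₁-σ-centred =
    ∀ P R → IsPartialOrder P R → IsσCentred P R →
    ∀ ω₁ 𝒟 d → IsOmega₁ ω₁ → IsFunction d ω₁ 𝒟 →
    (∀ α D → Related d α D → IsDense P R D) →
    ∃ λ G → IsFilter P R G ×
      (∀ α D → Related d α D → ∃ λ p → p ∈ D × p ∈ G)

  ZFC : Set ℓ
  ZFC = IsZFC

{-# OPTIONS --safe #-}
-- Let Y map every real x to a real Y(x) such that some slice contains x but
-- omits Y(x).  A σ-centred order, whose conditions are a finite part of a set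
-- c ⊆ ω together with finitely many reals x, adds a c from which Y(x) can be
-- decoded, given any x occurring in the generic filter.  For each α < ω₁ the
-- conditions in which some real outside M_α occurs are dense, so by MA there is
-- a c for which such an x exists for every α.  Now c lies in some M_α.  For the
-- corresponding x ∉ M_α let M_γ contain x and omit Y(x).  The slices increase, so
-- α < γ, hence M_γ contains both c and x, and therefore Y(x), a contradiction.
--
-- As in almost disjoint coding, c is a set of codes for initial segments of
-- reals.  It is itself a real, read in the same way by every slice, because finite
-- subsets of ω are coded by numbers through a binary counter, whose digits are
-- absolute.
module Submission where

open import Axiom.ExcludedMiddle using (ExcludedMiddle)
open import Data.Empty using (⊥; ⊥-elim)
open import Data.Fin.Base using (Fin; zero; suc)
open import Data.Nat.Base as ℕ using (ℕ)
open import Data.Product.Base using (_×_; _,_; ∃; proj₁; proj₂)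
open import Data.Sum.Base using (_⊎_; inj₁; inj₂; [_,_]′)
import Data.Sum.Base as Sum
open import Data.Vec.Base using (Vec; []; _∷_; lookup)
open import Data.Vec.Relation.Unary.All using (All; []; _∷_)
open import Function.Base using (id; _∘_)
open import Function.Bundles using (_⇔_; mk⇔; Equivalence)
open import Function.Construct.Composition using (_⇔-∘_)
open import Function.Construct.Identity using (⇔-id)
open import Function.Construct.Symmetry using (⇔-sym)
open import Level using (Level)
open import Relation.Binary.PropositionalEquality
  using (_≡_; refl; sym; trans; cong; cong₂; subst)
open import Relation.Nullary.Decidable.Core using (Dec; yes; no)
open import Relation.Nullary.Negation.Core using (¬_)
open import Defs

open Equivalence using (to; from)

-- The obstacle is that `Y` may lie outside every slice, so M_γ has to recover Y(x) from c, x and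
-- parameters on which all slices agree. This is why most notions are written as bounded formulas:
-- for these, separation inside a slice yields the same set as separation in the universe.
-- Membership in the slices is given by an arbitrary formula; it is first turned into a set
-- `members` of pairs ⟨α, x⟩, which can then be a parameter of bounded formulas.
--
-- A condition is a pair ⟨k, F⟩. The number k codes the finite part of c and also serves as its
-- length, since every position of a binary digit 1 of k is smaller than k. There are countably many
-- k, and finitely many conditions with the same k have a common lower bound, obtained by uniting
-- their sets F; this gives σ-centredness. Since ω ⊆ ω₁, the ω₁ dense sets can also demand that k
-- become arbitrarily large, which the decoding of Y(x) in full relies on.

private variable
  n : ℕ

pattern v0 = zero
pattern v1 = suc v0
pattern v2 = suc v1
pattern v3 = suc v2
pattern v4 = suc v3
pattern v5 = suc v4
pattern v6 = suc v5
pattern v7 = suc v6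
pattern v8 = suc v7
pattern v9 = suc v8
pattern v10 = suc v9
pattern v11 = suc v10
pattern v12 = suc v11
pattern v13 = suc v12

-- Bounded formulas and their translation

infix  9 _∈ᶠ_ _≡ᶠ_ _≡⟨_,_⟩ᶠ ⟨_,_⟩∈ᶠ_ _≡_⁺ᶠ
infix  8 ¬ᶠ_
infixr 7 _∧ᶠ_
infixr 6 _∨ᶠ_
infixr 5 _⇒ᶠ_ _⇔ᶠ_
infixr 4 ∀∈ ∃∈

-- Bounded formulas: they have the same meaning in every transitive class.
data BFormula : ℕ → Set where
  _∈ᶠ_ _≡ᶠ_ _≡_⁺ᶠ : Fin n → Fin n → BFormula n
  _≡⟨_,_⟩ᶠ ⟨_,_⟩∈ᶠ_ : Fin n → Fin n → Fin n → BFormula n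
  ¬ᶠ_ : BFormula n → BFormula n
  _∧ᶠ_ _∨ᶠ_ _⇒ᶠ_ _⇔ᶠ_ : BFormula n → BFormula n → BFormula n
  ∀∈ ∃∈ : Fin n → BFormula (ℕ.suc n) → BFormula n

pairᶠ : Fin n → Fin n → Fin n → Formula n
pairᶠ z x y = ∀′ (v0 ∊ suc z ⇔′ (v0 ≐ suc x ∨′ v0 ≐ suc y))

opairᶠ : Fin n → Fin n → Fin n → Formula n
opairᶠ z x y = ∃′ ∃′ (pairᶠ v1 (suc (suc x)) (suc (suc x))
  ∧′ pairᶠ v0 (suc (suc x)) (suc (suc y)) ∧′ pairᶠ (suc (suc z)) v1 v0)

-- The successor and pair atoms are spelled so that their satisfaction in a class unfolds to
-- `IsSuccessor`, `IsOrderedPair` and `Related`. Their quantifiers are unbounded, but a transitive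
-- class that contains the arguments still evaluates them correctly.
⌜_⌝ : BFormula n → Formula n
⌜ x ∈ᶠ y ⌝         = x ∊ y
⌜ x ≡ᶠ y ⌝         = x ≐ y
⌜ y ≡ x ⁺ᶠ ⌝       = ∀′ (v0 ∊ suc y ⇔′ (v0 ∊ suc x ∨′ v0 ≐ suc x))
⌜ z ≡⟨ x , y ⟩ᶠ ⌝  = opairᶠ z x y
⌜ ⟨ x , y ⟩∈ᶠ r ⌝  = ∃′ (v0 ∊ suc r ∧′ opairᶠ v0 (suc x) (suc y))
⌜ ¬ᶠ φ ⌝           = ¬′ ⌜ φ ⌝
⌜ φ ∧ᶠ ψ ⌝         = ⌜ φ ⌝ ∧′ ⌜ ψ ⌝
⌜ φ ∨ᶠ ψ ⌝         = ⌜ φ ⌝ ∨′ ⌜ ψ ⌝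
⌜ φ ⇒ᶠ ψ ⌝         = ⌜ φ ⌝ ⇒′ ⌜ ψ ⌝
⌜ φ ⇔ᶠ ψ ⌝         = ⌜ φ ⌝ ⇔′ ⌜ ψ ⌝
⌜ ∀∈ x φ ⌝         = ∀′ (v0 ∊ suc x ⇒′ ⌜ φ ⌝)
⌜ ∃∈ x φ ⌝         = ∃′ (v0 ∊ suc x ∧′ ⌜ φ ⌝)

⇔-fn : ∀ {a b c d} {A : Set a} {B : Set b} {C : Set c} {D : Set d} →
       A ⇔ B → C ⇔ D → (A → C) ⇔ (B → D)
⇔-fn p q = mk⇔ (λ f → to q ∘ f ∘ from p) (λ f → from q ∘ f ∘ to p)

-- Elementary operations on sets

module Sets {ℓ : Level} (em : ExcludedMiddle ℓ) (𝓥 : Structure ℓ)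
            (zfc : SetTheory.ZFC 𝓥) where

  open Structure 𝓥 renaming (Carrier to V)
  open SetTheory 𝓥
  module U = Within Universe
  open U.IsZFC zfc

  private variable
    a b c d r x y z : V

  by-contradiction : {P : Set ℓ} → ¬ ¬ P → P
  by-contradiction {P} f with em {P}
  ... | yes p = p
  ... | no ¬p = ⊥-elim (f ¬p)

  infix 4 _⊆_ _∉_
  _⊆_ _∉_ : V → V → Set ℓ
  a ⊆ b = ∀ {z} → z ∈ a → z ∈ b
  a ∉ b = ¬ a ∈ b

  ext : a ⊆ b → b ⊆ a → a ≡ b
  ext f g = extensionality _ _ _ _ λ _ _ → mk⇔ f g

  infixr 6 _∪_
  infix  10 _⁺

  pair : V → V → V
  pair x y = proj₁ (pairing x _ y _)

  ∈pair : z ∈ pair x y ⇔ (z ≡ x ⊎ z ≡ y)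
  ∈pair = proj₂ (proj₂ (pairing _ _ _ _)) _ _

  pair-left : x ∈ pair x y
  pair-left = from ∈pair (inj₁ refl)

  pair-right : y ∈ pair x y
  pair-right = from ∈pair (inj₂ refl)

  ⋃ : V → V
  ⋃ x = proj₁ (union x _)

  ∈⋃ : z ∈ ⋃ x ⇔ ∃ λ y → y ∈ x × z ∈ y
  ∈⋃ = mk⇔ (λ p → let (y , _ , q) = to h p in y , q)
            (λ (y , q) → from h (y , _ , q))
    where h = proj₂ (proj₂ (union _ _)) _ _

  _∪_ : V → V → V
  a ∪ b = ⋃ (pair a b)

  ∈∪ : z ∈ a ∪ b ⇔ (z ∈ a ⊎ z ∈ b)
  ∈∪ {z} {a} {b} = mk⇔ f g
    where
      f : z ∈ a ∪ b → z ∈ a ⊎ z ∈ b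
      f p with to ∈⋃ p
      ... | y , q , r with to ∈pair q
      ... | inj₁ refl = inj₁ r
      ... | inj₂ refl = inj₂ r
      g : z ∈ a ⊎ z ∈ b → z ∈ a ∪ b
      g (inj₁ p) = from ∈⋃ (a , pair-left , p)
      g (inj₂ p) = from ∈⋃ (b , pair-right , p)

  ❴_❵ : V → V
  ❴ x ❵ = pair x x

  ∈❴❵ : z ∈ ❴ x ❵ → z ≡ x
  ∈❴❵ p = [ id , id ]′ (to ∈pair p)

  _⁺ : V → V
  x ⁺ = x ∪ ❴ x ❵

  ∈⁺ : z ∈ x ⁺ ⇔ (z ∈ x ⊎ z ≡ x)
  ∈⁺ = mk⇔ (Sum.map₂ ∈❴❵ ∘ to ∈∪)
           (from ∈∪ ∘ Sum.map₂ (λ { refl → pair-left }))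

  self∈⁺ : x ∈ x ⁺
  self∈⁺ = from ∈⁺ (inj₂ refl)

  ⊆⁺ : x ⊆ x ⁺
  ⊆⁺ = from ∈⁺ ∘ inj₁

  𝒫 : V → V
  𝒫 x = proj₁ (powerset x _)

  ∈𝒫 : z ∈ 𝒫 x ⇔ z ⊆ x
  ∈𝒫 {z} {x} = mk⇔ f g
    where
      h = proj₂ (proj₂ (powerset x _)) z _
      f : z ∈ 𝒫 x → z ⊆ x
      f p = to h p _ _
      g : z ⊆ x → z ∈ 𝒫 x
      g q = from h λ _ _ → q

  ∈-minimal : x ∈ a → ∃ λ y → y ∈ a × (∀ {z} → z ∈ y → z ∉ a)
  ∈-minimal p with foundation _ _ (_ , _ , p)
  ... | y , _ , q , h = y , q , λ r s → h (_ , _ , r , s)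

  ∈-irrefl : x ∉ x
  ∈-irrefl p with ∈-minimal pair-left
  ... | y , q , h with ∈❴❵ q
  ... | refl = h p q

  ∈-asym : x ∈ y → y ∉ x
  ∈-asym p q with ∈-minimal pair-left
  ... | z , r , h with to ∈pair r
  ... | inj₁ refl = h q pair-right
  ... | inj₂ refl = h p pair-left

  ⁺-injective : x ⁺ ≡ y ⁺ → x ≡ y
  ⁺-injective {x} {y} e with to ∈⁺ (subst (x ∈_) e self∈⁺)
                        | to ∈⁺ (subst (y ∈_) (sym e) self∈⁺)
  ... | inj₂ p | _      = p
  ... | inj₁ _ | inj₂ q = sym q
  ... | inj₁ p | inj₁ q = ⊥-elim (∈-asym p q)

  ⟨_,_⟩ : V → V → V
  ⟨ x , y ⟩ = pair ❴ x ❵ (pair x y)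

  pair-injectiveʳ : pair a b ≡ pair a c → b ≡ c
  pair-injectiveʳ {a} {b} {c} e
    with to ∈pair (subst (b ∈_) e pair-right) | to ∈pair (subst (c ∈_) (sym e) pair-right)
  ... | inj₂ p    | _         = p
  ... | inj₁ refl | inj₁ refl = refl
  ... | inj₁ refl | inj₂ refl = refl

  ⟨⟩-injectiveˡ : ⟨ a , b ⟩ ≡ ⟨ c , d ⟩ → a ≡ c
  ⟨⟩-injectiveˡ {a} {c = c} e with to ∈pair (subst (❴ a ❵ ∈_) e pair-left)
  ... | inj₁ p = sym (∈❴❵ (subst (c ∈_) (sym p) pair-left))
  ... | inj₂ p = sym (∈❴❵ (subst (c ∈_) (sym p) pair-left))

  ⟨⟩-injective : ⟨ a , b ⟩ ≡ ⟨ c , d ⟩ → a ≡ c × b ≡ d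
  ⟨⟩-injective e with ⟨⟩-injectiveˡ e
  ... | refl = refl , pair-injectiveʳ (pair-injectiveʳ e)

  ⟦_⟧ : BFormula n → Vec V n → Set ℓ
  ⟦ i ∈ᶠ j ⟧ ρ        = lookup ρ i ∈ lookup ρ j
  ⟦ i ≡ᶠ j ⟧ ρ        = lookup ρ i ≡ lookup ρ j
  ⟦ i ≡ j ⁺ᶠ ⟧ ρ      = lookup ρ i ≡ lookup ρ j ⁺
  ⟦ i ≡⟨ j , k ⟩ᶠ ⟧ ρ = lookup ρ i ≡ ⟨ lookup ρ j , lookup ρ k ⟩
  ⟦ ⟨ i , j ⟩∈ᶠ k ⟧ ρ = ⟨ lookup ρ i , lookup ρ j ⟩ ∈ lookup ρ k
  ⟦ ¬ᶠ φ ⟧ ρ          = ¬ ⟦ φ ⟧ ρ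
  ⟦ φ ∧ᶠ ψ ⟧ ρ        = ⟦ φ ⟧ ρ × ⟦ ψ ⟧ ρ
  ⟦ φ ∨ᶠ ψ ⟧ ρ        = ⟦ φ ⟧ ρ ⊎ ⟦ ψ ⟧ ρ
  ⟦ φ ⇒ᶠ ψ ⟧ ρ        = ⟦ φ ⟧ ρ → ⟦ ψ ⟧ ρ
  ⟦ φ ⇔ᶠ ψ ⟧ ρ        = ⟦ φ ⟧ ρ ⇔ ⟦ ψ ⟧ ρ
  ⟦ ∀∈ i φ ⟧ ρ        = ∀ x → x ∈ lookup ρ i → ⟦ φ ⟧ (x ∷ ρ)
  ⟦ ∃∈ i φ ⟧ ρ        = ∃ λ x → x ∈ lookup ρ i × ⟦ φ ⟧ (x ∷ ρ)

  -- Absoluteness of bounded formulas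

  module Absoluteness {M : Class} (M-transitive : ∀ {x y} → M x → y ∈ x → M y) where

    module W = Within M

    lookupᴹ : {ρ : Vec V n} → All M ρ → ∀ i → M (lookup ρ i)
    lookupᴹ (m ∷ _)  zero    = m
    lookupᴹ (_ ∷ ms) (suc i) = lookupᴹ ms i

    pair-absolute : M z → M x → M y → W.IsPair z x y ⇔ z ≡ pair x y
    pair-absolute {z} {x} {y} mz mx my = mk⇔ f g
      where
        g : z ≡ pair x y → W.IsPair z x y
        g refl w _ = ∈pair
        f : W.IsPair z x y → z ≡ pair x y
        f h = ext (λ p → from ∈pair (to (h _ (M-transitive mz p)) p)) k
          where
            k : pair x y ⊆ z
            k p with to ∈pair p
            ... | inj₁ refl = from (h _ mx) (inj₁ refl)
            ... | inj₂ refl = from (h _ my) (inj₂ refl)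

    opair-absolute : M z → M x → M y → W.IsOrderedPair z x y ⇔ z ≡ ⟨ x , y ⟩
    opair-absolute {z} {x} {y} mz mx my = mk⇔ f g
      where
        f : W.IsOrderedPair z x y → z ≡ ⟨ x , y ⟩
        f (u , mu , v , mv , p , q , r)
          with to (pair-absolute mu mx mx) p | to (pair-absolute mv mx my) q
        ... | refl | refl = to (pair-absolute mz mu mv) r
        g : z ≡ ⟨ x , y ⟩ → W.IsOrderedPair z x y
        g refl = _ , mu , _ , mv , from (pair-absolute mu mx mx) refl ,
                 from (pair-absolute mv mx my) refl , from (pair-absolute mz mu mv) refl
          where
            mu = M-transitive mz pair-left
            mv = M-transitive mz pair-right

    related-absolute : M r → M x → M y → W.Related r x y ⇔ ⟨ x , y ⟩ ∈ r
    related-absolute mr mx my = mk⇔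
      (λ (z , mz , p , q) → subst (_∈ _) (to (opair-absolute mz mx my) q) p)
      (λ p → let mz = M-transitive mr p in
             _ , mz , p , from (opair-absolute mz mx my) refl)

    successor-absolute : M y → M x → W.IsSuccessor y x ⇔ y ≡ x ⁺
    successor-absolute {y} {x} my mx = mk⇔ f (λ { refl w _ → ∈⁺ })
      where
        f : W.IsSuccessor y x → y ≡ x ⁺
        f h = ext (λ p → from ∈⁺ (to (h _ (M-transitive my p)) p)) k
          where
            k : x ⁺ ⊆ y
            k p with to ∈⁺ p
            ... | inj₁ q    = from (h _ (M-transitive mx q)) (inj₁ q)
            ... | inj₂ refl = from (h _ mx) (inj₂ refl)

    -- At a bounded quantifier, transitivity puts every element of the bound into `M`. Besides
    -- comparing a slice with the universe, the case `M = Universe` turns instances of the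
    -- separation scheme into statements about `⟦_⟧`.
    absolute : (φ : BFormula n) {ρ : Vec V n} → All M ρ → W.Sat ⌜ φ ⌝ ρ ⇔ ⟦ φ ⟧ ρ
    absolute (i ∈ᶠ j) ms = ⇔-id _
    absolute (i ≡ᶠ j) ms = ⇔-id _
    absolute (i ≡ j ⁺ᶠ) ms = successor-absolute (lookupᴹ ms i) (lookupᴹ ms j)
    absolute (i ≡⟨ j , k ⟩ᶠ) ms =
      opair-absolute (lookupᴹ ms i) (lookupᴹ ms j) (lookupᴹ ms k)
    absolute (⟨ i , j ⟩∈ᶠ k) ms =
      related-absolute (lookupᴹ ms k) (lookupᴹ ms i) (lookupᴹ ms j)
    absolute (¬ᶠ φ) ms = ⇔-fn (absolute φ ms) (⇔-id _)
    absolute (φ ∧ᶠ ψ) ms = mk⇔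
      (λ (p , q) → to (absolute φ ms) p , to (absolute ψ ms) q)
      (λ (p , q) → from (absolute φ ms) p , from (absolute ψ ms) q)
    absolute (φ ∨ᶠ ψ) ms = mk⇔
      (Sum.map (to (absolute φ ms)) (to (absolute ψ ms)))
      (Sum.map (from (absolute φ ms)) (from (absolute ψ ms)))
    absolute (φ ⇒ᶠ ψ) ms = ⇔-fn (absolute φ ms) (absolute ψ ms)
    absolute (φ ⇔ᶠ ψ) ms = mk⇔
      (λ h → absolute ψ ms ⇔-∘ (h ⇔-∘ ⇔-sym (absolute φ ms)))
      (λ h → ⇔-sym (absolute ψ ms) ⇔-∘ (h ⇔-∘ absolute φ ms))
    absolute (∀∈ i φ) ms = mk⇔
      (λ h x p → let m = M-transitive (lookupᴹ ms i) p in
                 to (absolute φ (m ∷ ms)) (h x m p))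
      (λ h x m p → from (absolute φ (m ∷ ms)) (h x p))
    absolute (∃∈ i φ) ms = mk⇔
      (λ (x , m , p , h) → x , p , to (absolute φ (m ∷ ms)) h)
      (λ (x , p , h) → let m = M-transitive (lookupᴹ ms i) p in
                       x , m , p , from (absolute φ (m ∷ ms)) h)

  module UA = Absoluteness {Universe} (λ _ _ → _)

  allᵁ : (ρ : Vec V n) → All Universe ρ
  allᵁ []      = []
  allᵁ (_ ∷ ρ) = _ ∷ allᵁ ρ

  abstract
    sep : BFormula (ℕ.suc n) → Vec V n → V → V
    sep φ ρ a = proj₁ (separation ⌜ φ ⌝ ρ (allᵁ ρ) a _)

    ∈sep : (φ : BFormula (ℕ.suc n)) {ρ : Vec V n} →
           z ∈ sep φ ρ a ⇔ (z ∈ a × ⟦ φ ⟧ (z ∷ ρ))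
    ∈sep {z = z} {a} φ {ρ} = mk⇔
        (λ p → let (q , s) = to h p in q , to (UA.absolute φ (allᵁ _)) s)
        (λ (q , s) → from h (q , from (UA.absolute φ (allᵁ _)) s))
      where
        h : z ∈ sep φ ρ a ⇔ (z ∈ a × U.Sat ⌜ φ ⌝ (z ∷ ρ))
        h = proj₂ (proj₂ (separation ⌜ φ ⌝ ρ (allᵁ ρ) a _)) z _

-- Products, definable relations and uniformization

module Naturals {ℓ : Level} (em : ExcludedMiddle ℓ) (𝓥 : Structure ℓ)
                (zfc : SetTheory.ZFC 𝓥) where

  open Structure 𝓥 renaming (Carrier to V)
  open SetTheory 𝓥
  open Sets em 𝓥 zfc public
  open U.IsZFC zfc using (infinity; choice)

  private variable
    a b i j k r w x y z : V

  infixr 7 _⊗_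

  abstract
    _⊗_ : V → V → V
    a ⊗ b = sep (∃∈ v1 (∃∈ v3 (v2 ≡⟨ v1 , v0 ⟩ᶠ))) (a ∷ b ∷ []) (𝒫 (𝒫 (a ∪ b)))

    ⟨⟩∈𝒫𝒫 : x ∈ a → y ∈ b → ⟨ x , y ⟩ ∈ 𝒫 (𝒫 (a ∪ b))
    ⟨⟩∈𝒫𝒫 {x} {a} {y} {b} p q = from ∈𝒫 h
      where
        x∈ : x ∈ a ∪ b
        x∈ = from ∈∪ (inj₁ p)
        y∈ : y ∈ a ∪ b
        y∈ = from ∈∪ (inj₂ q)
        pair⊆ : z ∈ a ∪ b → pair x z ⊆ a ∪ b
        pair⊆ z∈ r with to ∈pair r
        ... | inj₁ refl = x∈
        ... | inj₂ refl = z∈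
        h : ⟨ x , y ⟩ ⊆ 𝒫 (a ∪ b)
        h r with to ∈pair r
        ... | inj₁ refl = from ∈𝒫 (pair⊆ x∈)
        ... | inj₂ refl = from ∈𝒫 (pair⊆ y∈)

    ∈⊗ : z ∈ a ⊗ b ⇔ (∃ λ x → x ∈ a × ∃ λ y → y ∈ b × z ≡ ⟨ x , y ⟩)
    ∈⊗ {z} {a} {b} = mk⇔ (proj₂ ∘ to (∈sep _)) g
      where
        g : (∃ λ x → x ∈ a × ∃ λ y → y ∈ b × z ≡ ⟨ x , y ⟩) → z ∈ a ⊗ b
        g (x , p , y , q , refl) = from (∈sep _) (⟨⟩∈𝒫𝒫 p q , x , p , y , q , refl)

    ⟨⟩∈⊗ : ⟨ x , y ⟩ ∈ a ⊗ b ⇔ (x ∈ a × y ∈ b)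
    ⟨⟩∈⊗ {x} {y} {a} {b} = mk⇔ f (λ (p , q) → from ∈⊗ (_ , p , _ , q , refl))
      where
        f : ⟨ x , y ⟩ ∈ a ⊗ b → x ∈ a × y ∈ b
        f h with to ∈⊗ h
        ... | _ , p , _ , q , e with ⟨⟩-injective e
        ... | refl , refl = p , q

    -- The relation { ⟨x, y⟩ ∈ a × b | φ }; the free variables of φ are
    -- y, x, ⟨x, y⟩, a, b, ρ in this order.
    graph : BFormula (5 ℕ.+ n) → Vec V n → V → V → V
    graph φ ρ a b = sep (∃∈ v1 (∃∈ v3 (v2 ≡⟨ v1 , v0 ⟩ᶠ ∧ᶠ φ))) (a ∷ b ∷ ρ) (a ⊗ b)

    ∈graph : (φ : BFormula (5 ℕ.+ n)) {ρ : Vec V n} → ⟨ x , y ⟩ ∈ graph φ ρ a b ⇔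
             (x ∈ a × y ∈ b × ⟦ φ ⟧ (y ∷ x ∷ ⟨ x , y ⟩ ∷ a ∷ b ∷ ρ))
    ∈graph {x = x} {y} {a} {b} φ {ρ} = mk⇔ f
        (λ (p , q , h) → from (∈sep _) (from ⟨⟩∈⊗ (p , q) , _ , p , _ , q , refl , h))
      where
        f : ⟨ x , y ⟩ ∈ graph φ ρ a b →
            x ∈ a × y ∈ b × ⟦ φ ⟧ (y ∷ x ∷ ⟨ x , y ⟩ ∷ a ∷ b ∷ ρ)
        f h with to (∈sep _) h
        ... | _ , _ , p , _ , q , e , s with ⟨⟩-injective e
        ... | refl , refl = p , q , s

    graph⊆⊗ : (φ : BFormula (5 ℕ.+ n)) {ρ : Vec V n} → graph φ ρ a b ⊆ a ⊗ b
    graph⊆⊗ φ p = proj₁ (to (∈sep _) p)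

  opair : U.IsOrderedPair z x y ⇔ z ≡ ⟨ x , y ⟩
  opair = UA.opair-absolute _ _ _

  related : U.Related r x y ⇔ ⟨ x , y ⟩ ∈ r
  related = UA.related-absolute _ _ _

  relation⁺ : r ⊆ a ⊗ b → U.IsRelation r a b
  relation⁺ h z _ p with to ∈⊗ (h p)
  ... | x , q , y , s , e = x , _ , y , _ , q , s , from opair e

  relation⁻ : U.IsRelation r a b → r ⊆ a ⊗ b
  relation⁻ h p with h _ _ p
  ... | x , _ , y , _ , q , s , e = from ∈⊗ (x , q , y , s , to opair e)

  function⁺ : r ⊆ a ⊗ b → (∀ {x} → x ∈ a → ∃ λ y → ⟨ x , y ⟩ ∈ r) →
              (∀ {x y z} → ⟨ x , y ⟩ ∈ r → ⟨ x , z ⟩ ∈ r → y ≡ z) → U.IsFunction r a b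
  function⁺ h t s = relation⁺ h ,
    (λ _ _ p → let (y , q) = t p in y , _ , from related q) ,
    (λ _ _ _ _ _ _ p q → s (to related p) (to related q))

  -- The family of centred sets and the family of dense sets arise as operations `V → V`, whereas
  -- σ-centredness and Martin's axiom ask for functions that are sets; this supplies them.
  function-graph : (φ : BFormula (5 ℕ.+ n)) (ρ : Vec V n) (F : V → V) →
    (∀ {x} → x ∈ a → F x ∈ b) →
    (∀ {x y} → x ∈ a → y ∈ b → ⟦ φ ⟧ (y ∷ x ∷ ⟨ x , y ⟩ ∷ a ∷ b ∷ ρ) ⇔ y ≡ F x) →
    U.IsFunction (graph φ ρ a b) a b ×
    (∀ {x y} → ⟨ x , y ⟩ ∈ graph φ ρ a b ⇔ (x ∈ a × y ≡ F x))
  function-graph {a = a} {b} φ ρ F F∈ h = function⁺ (graph⊆⊗ φ)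
      (λ p → _ , from char (p , refl))
      (λ p q → trans (proj₂ (to char p)) (sym (proj₂ (to char q)))) , char
    where
      g : x ∈ a × y ≡ F x → ⟨ x , y ⟩ ∈ graph φ ρ a b
      g (p , refl) = from (∈graph φ) (p , F∈ p , from (h p (F∈ p)) refl)
      char : ⟨ x , y ⟩ ∈ graph φ ρ a b ⇔ (x ∈ a × y ≡ F x)
      char = mk⇔ (λ p → let (q , s , t) = to (∈graph φ) p in q , to (h q s) t) g

  -- Expresses an equation with a separated set by a bounded formula, as `function-graph` requires
  -- when the values are such sets.
  ≡sep : (φ : BFormula (ℕ.suc n)) {ρ : Vec V n} → a ∈ 𝒫 b →
         (∀ z → z ∈ b → z ∈ a ⇔ ⟦ φ ⟧ (z ∷ ρ)) ⇔ a ≡ sep φ ρ b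
  ≡sep {a = a} {b} φ {ρ} a⊆ = mk⇔
      (λ h → ext (λ p → let q = to ∈𝒫 a⊆ p in from (∈sep φ) (q , to (h _ q) p))
                 (λ p → let (q , s) = to (∈sep φ) p in from (h _ q) s))
      g
    where
      g : a ≡ sep φ ρ b → ∀ z → z ∈ b → z ∈ a ⇔ ⟦ φ ⟧ (z ∷ ρ)
      g refl z q = mk⇔ (proj₂ ∘ to (∈sep φ)) (λ s → from (∈sep φ) (q , s))

  -- The axiom of choice is given for disjoint families only, so it is applied to the fibres of `r`,
  -- kept as sets of pairs: a common element of two fibres determines the first coordinate and hence
  -- the fibre. The nonempty fibres form a set because they are definable in `𝒫 r`.
  uniformize : r ⊆ a ⊗ b → ∃ λ f → f ⊆ r ×
    (∀ {x y} → ⟨ x , y ⟩ ∈ r → ∃ λ z → ⟨ x , z ⟩ ∈ f) ×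
    (∀ {x y z} → ⟨ x , y ⟩ ∈ f → ⟨ x , z ⟩ ∈ f → y ≡ z)
  uniformize {r} {a} {b} r⊆ = f , proj₁ ∘ to ∈f , total , functional
    where
      fibreᶠ : BFormula 3
      fibreᶠ = ∃∈ v1 (v1 ≡⟨ v3 , v0 ⟩ᶠ)
      fibre : V → V
      fibre x = sep fibreᶠ (b ∷ x ∷ []) r
      fibresᶠ : BFormula 4
      fibresᶠ = ∃∈ v1 (∃∈ v1 (v0 ≡ᶠ v0) ∧ᶠ
                  ∀∈ v4 (v0 ∈ᶠ v2 ⇔ᶠ ∃∈ v4 (v1 ≡⟨ v2 , v0 ⟩ᶠ)))
      fibres : V
      fibres = sep fibresᶠ (a ∷ b ∷ r ∷ []) (𝒫 r)
      fibre∈ : ⟨ x , y ⟩ ∈ r → fibre x ∈ fibres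
      fibre∈ {x} {y} p = from (∈sep fibresᶠ) (from ∈𝒫 (proj₁ ∘ to (∈sep fibreᶠ)) ,
          x , x∈ , (⟨ x , y ⟩ , from (∈sep fibreᶠ) (p , y , y∈ , refl) , refl) ,
          λ z q → mk⇔ (proj₂ ∘ to (∈sep fibreᶠ)) (λ s → from (∈sep fibreᶠ) (q , s)))
        where
          x∈ = proj₁ (to ⟨⟩∈⊗ (r⊆ p))
          y∈ = proj₂ (to ⟨⟩∈⊗ (r⊆ p))
      choiceSet : ∃ λ c → Universe c × (∀ y → Universe y → y ∈ fibres →
        ∃ λ z → Universe z × (z ∈ y × z ∈ c) × (∀ w → Universe w → w ∈ y → w ∈ c → w ≡ z))
      choiceSet = choice fibres _
          (λ _ _ p → let (_ , _ , _ , (z , q , _) , _) = to (∈sep fibresᶠ) p in z , _ , q)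
          disjoint
        where
          disjoint : ∀ s → Universe s → ∀ t → Universe t → s ∈ fibres → t ∈ fibres →
                     (∃ λ z → Universe z × z ∈ s × z ∈ t) → s ≡ t
          disjoint s _ t _ p q (z , _ , z∈s , z∈t)
            with to (∈sep fibresᶠ) p | to (∈sep fibresᶠ) q
          ... | s⊆ , x , _ , _ , hs | t⊆ , x′ , _ , _ , ht
            with to (hs z (to ∈𝒫 s⊆ z∈s)) z∈s | to (ht z (to ∈𝒫 t⊆ z∈t)) z∈t
          ... | _ , _ , e | _ , _ , e′ with ⟨⟩-injective (trans (sym e) e′)
          ... | refl , _ = ext
            (λ u → let v = to ∈𝒫 s⊆ u in from (ht _ v) (to (hs _ v) u))
            (λ u → let v = to ∈𝒫 t⊆ u in from (hs _ v) (to (ht _ v) u))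
      C = proj₁ choiceSet
      selected = proj₂ (proj₂ choiceSet)
      f = sep (v0 ∈ᶠ v1) (C ∷ []) r
      ∈f : z ∈ f ⇔ (z ∈ r × z ∈ C)
      ∈f = ∈sep (v0 ∈ᶠ v1)
      total : ⟨ x , y ⟩ ∈ r → ∃ λ z → ⟨ x , z ⟩ ∈ f
      total p with selected _ _ (fibre∈ p)
      ... | _ , _ , (q , s) , _ with to (∈sep fibreᶠ) q
      ... | t , z , _ , refl = z , from ∈f (t , s)
      functional : ⟨ x , y ⟩ ∈ f → ⟨ x , z ⟩ ∈ f → y ≡ z
      functional p q with to ∈f p | to ∈f q
      ... | p₁ , p₂ | q₁ , q₂ with selected _ _ (fibre∈ p₁)
      ... | _ , _ , _ , unique = proj₂ (⟨⟩-injective (trans (u p₁ p₂) (sym (u q₁ q₂))))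
        where
          u = λ {t} p₁ p₂ → unique _ _ (from (∈sep fibreᶠ)
            (p₁ , t , proj₂ (to ⟨⟩∈⊗ (r⊆ p₁)) , refl)) p₂

  -- Ordinals

  IsTrans Ord : V → Set ℓ
  IsTrans x = ∀ y → y ∈ x → y ⊆ x
  Ord x = IsTrans x × (∀ y → y ∈ x → IsTrans y)

  trans⁺ : IsTrans x → U.IsTransitive x
  trans⁺ h y _ p _ _ = h y p

  trans⁻ : U.IsTransitive x → IsTrans x
  trans⁻ h y p = h y _ p _ _

  ord⁺ : Ord x → U.IsOrdinal x
  ord⁺ (p , q) = trans⁺ p , λ y _ r → trans⁺ (q y r)

  ord⁻ : U.IsOrdinal x → Ord x
  ord⁻ (p , q) = trans⁻ p , λ y r → trans⁻ (q y _ r)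

  Ord-∈ : Ord x → y ∈ x → Ord y
  Ord-∈ (p , q) r = q _ r , λ z s → q z (p _ r s)

  Ord-⁺ : Ord x → Ord (x ⁺)
  Ord-⁺ {x} (p , q) = t , u
    where
      t : IsTrans (x ⁺)
      t y r with to ∈⁺ r
      ... | inj₁ s    = ⊆⁺ ∘ p y s
      ... | inj₂ refl = ⊆⁺
      u : ∀ y → y ∈ x ⁺ → IsTrans y
      u y r with to ∈⁺ r
      ... | inj₁ s    = q y s
      ... | inj₂ refl = p

  Comparable : V → V → Set ℓ
  Comparable x y = x ∈ y ⊎ x ≡ y ⊎ y ∈ x

  comparableᶠ : Fin n → Fin n → BFormula n
  comparableᶠ i j = i ∈ᶠ j ∨ᶠ i ≡ᶠ j ∨ᶠ j ∈ᶠ i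

  -- An ∈-minimal c ∈ a⁺ incomparable with some element of b⁺ and an ∈-minimal
  -- d ∈ b⁺ incomparable with c would have the same elements.
  ¬incomparable : Ord a → Ord b → ¬ ¬ Comparable a b
  ¬incomparable {a} {b} oa ob = contra
    where
      sᶠ : BFormula 2
      sᶠ = ∃∈ v1 (¬ᶠ comparableᶠ v1 v0)
      tᶠ : BFormula 2
      tᶠ = ¬ᶠ comparableᶠ v1 v0
      contra : ¬ ¬ Comparable a b
      contra nc with ∈-minimal (from (∈sep sᶠ {ρ = b ⁺ ∷ []})
                                 (self∈⁺ , b , self∈⁺ , nc))
      ... | c , c∈ , cmin with to (∈sep sᶠ) c∈
      ... | c∈a⁺ , d₀ , d₀∈ , nc₀ with ∈-minimal (from (∈sep tᶠ {ρ = c ∷ []}) (d₀∈ , nc₀))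
      ... | d , d∈ , dmin with to (∈sep tᶠ) d∈
      ... | d∈b⁺ , ncd = ncd (inj₂ (inj₁ (ext c⊆d d⊆c)))
        where
          oc = Ord-∈ (Ord-⁺ oa) c∈a⁺
          od = Ord-∈ (Ord-⁺ ob) d∈b⁺
          c⊆d : c ⊆ d
          c⊆d {e} p with by-contradiction (λ h → cmin p
            (from (∈sep sᶠ) (proj₁ (Ord-⁺ oa) c c∈a⁺ p , d , d∈b⁺ , h)))
          ... | inj₁ q           = q
          ... | inj₂ (inj₁ refl) = ⊥-elim (ncd (inj₂ (inj₂ p)))
          ... | inj₂ (inj₂ q)    = ⊥-elim (ncd (inj₂ (inj₂ (proj₁ oc e p q))))
          d⊆c : d ⊆ c
          d⊆c {e} p with by-contradiction (λ h → dmin p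
            (from (∈sep tᶠ) (proj₁ (Ord-⁺ ob) d d∈b⁺ p , h)))
          ... | inj₁ q           = ⊥-elim (ncd (inj₁ (proj₁ od e p q)))
          ... | inj₂ (inj₁ refl) = ⊥-elim (ncd (inj₁ p))
          ... | inj₂ (inj₂ q)    = q

  abstract
    compare : Ord a → Ord b → Comparable a b
    compare oa ob = by-contradiction (¬incomparable oa ob)

  -- The natural numbers

  private
    I : V
    I = proj₁ infinity

  ∅ : V
  ∅ = proj₁ (proj₁ (proj₂ (proj₂ infinity)))

  ∉∅ : x ∉ ∅
  ∉∅ = proj₂ (proj₂ (proj₂ (proj₁ (proj₂ (proj₂ infinity))))) _ _

  private
    ∅∈I : ∅ ∈ I
    ∅∈I = proj₁ (proj₂ (proj₂ (proj₁ (proj₂ (proj₂ infinity)))))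

    ⁺∈I : x ∈ I → x ⁺ ∈ I
    ⁺∈I p with proj₂ (proj₂ (proj₂ infinity)) _ _ p
    ... | s , _ , q , h with to (UA.successor-absolute _ _) h
    ... | refl = q

    -- Membership in every inductive subset of `I`; quantifying over `𝒫 I` makes this a bounded
    -- formula.
    ωᶠ : BFormula 3
    ωᶠ = ∀∈ v1 ((v3 ∈ᶠ v0 ∧ᶠ ∀∈ v0 (∃∈ v1 (v0 ≡ v1 ⁺ᶠ))) ⇒ᶠ v1 ∈ᶠ v0)

  abstract
    ω : V
    ω = sep ωᶠ (𝒫 I ∷ ∅ ∷ []) I

    ∅∈ω : ∅ ∈ ω
    ∅∈ω = from (∈sep ωᶠ) (∅∈I , λ _ _ → proj₁)

    ⁺∈ω : x ∈ ω → x ⁺ ∈ ω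
    ⁺∈ω {x} p with to (∈sep ωᶠ) p
    ... | q , h = from (∈sep ωᶠ) (⁺∈I q , step)
      where
        step : ⟦ ωᶠ ⟧ (x ⁺ ∷ 𝒫 I ∷ ∅ ∷ [])
        step J J∈ (z , s) with s x (h J J∈ (z , s))
        ... | _ , r , refl = r

    -- The numbers satisfying `φ` form an inductive subset of `I`. Since `sep` takes bounded
    -- formulas, each later induction has to write its claim as one.
    ω-induction : (φ : BFormula (ℕ.suc n)) (ρ : Vec V n) → ⟦ φ ⟧ (∅ ∷ ρ) →
                  (∀ {k} → k ∈ ω → ⟦ φ ⟧ (k ∷ ρ) → ⟦ φ ⟧ (k ⁺ ∷ ρ)) →
                  ∀ {k} → k ∈ ω → ⟦ φ ⟧ (k ∷ ρ)
    ω-induction φ ρ base step {k} p =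
        proj₂ (to (∈sep φ) (proj₂ (to (∈sep ωᶠ) p) J J∈ (J∅ , λ x q → x ⁺ , J⁺ q , refl)))
      where
        J : V
        J = sep φ ρ ω
        J∈ : J ∈ 𝒫 I
        J∈ = from ∈𝒫 (proj₁ ∘ to (∈sep ωᶠ) ∘ proj₁ ∘ to (∈sep φ))
        J∅ : ∅ ∈ J
        J∅ = from (∈sep φ) (∅∈ω , base)
        J⁺ : x ∈ J → x ⁺ ∈ J
        J⁺ q = let (r , s) = to (∈sep φ) q in from (∈sep φ) (⁺∈ω r , step r s)

  abstract
    ω-transitive : IsTrans ω
    ω-transitive k p q = ω-induction (∀∈ v0 (v0 ∈ᶠ v2)) (ω ∷ [])
      (λ _ r → ⊥-elim (∉∅ r))
      (λ k∈ h x r → [ h x , (λ { refl → k∈ }) ]′ (to ∈⁺ r)) p _ q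

    ω-ord : Ord ω
    ω-ord = ω-transitive , λ k p y q {_} → ω-induction (∀∈ v0 (∀∈ v0 (v0 ∈ᶠ v2))) []
      (λ _ r → ⊥-elim (∉∅ r))
      (λ k∈ h x r z s → ⊆⁺ ([ (λ t → h x t z s) , (λ { refl → s }) ]′ (to ∈⁺ r))) p y q _

    nat-ord : k ∈ ω → Ord k
    nat-ord = Ord-∈ ω-ord

    ∈-nat-trans : k ∈ ω → x ∈ y → y ∈ k → x ∈ k
    ∈-nat-trans k∈ p q = proj₁ (nat-ord k∈) _ q p

    zero-or-suc : k ∈ ω → k ≡ ∅ ⊎ ∃ λ j → j ∈ ω × k ≡ j ⁺
    zero-or-suc = ω-induction (v0 ≡ᶠ v1 ∨ᶠ ∃∈ v2 (v1 ≡ v0 ⁺ᶠ)) (∅ ∷ ω ∷ [])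
      (inj₁ refl) (λ k∈ _ → inj₂ (_ , k∈ , refl))

  ω-limit : U.IsLimit ω
  ω-limit = ord⁺ ω-ord , (∅ , _ , ∅∈ω) ,
    λ k _ p → k ⁺ , _ , ⁺∈ω p , from (UA.successor-absolute _ _) refl

  ω-isOmega : U.IsOmega ω
  ω-isOmega = ω-limit , h
    where
      h : ∀ k → Universe k → k ∈ ω → ¬ U.IsLimit k
      h k _ p (_ , (x , _ , q) , s) with zero-or-suc p
      ... | inj₁ refl = ∉∅ q
      ... | inj₂ (j , _ , refl) with s j _ self∈⁺
      ... | _ , _ , r , t with to (UA.successor-absolute _ _) t
      ... | refl = ∈-irrefl r

  -- Of two distinct ordinals one contains the other, but both are limits without a limit below.
  -- This replaces the ω hidden in the definitions of finiteness, countability and reals by the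
  -- fixed `ω`.
  isOmega-unique : U.IsOmega w → w ≡ ω
  isOmega-unique (l , h) with compare (ord⁻ (proj₁ l)) ω-ord
  ... | inj₁ p        = ⊥-elim (proj₂ ω-isOmega _ _ p l)
  ... | inj₂ (inj₁ e) = e
  ... | inj₂ (inj₂ p) = ⊥-elim (h _ _ p ω-limit)

  abstract
    ω-bound : j ∈ ω → k ∈ ω → ∃ λ m → m ∈ ω × j ∈ m × k ∈ m
    ω-bound {j} {k} p q with compare (nat-ord p) (nat-ord q)
    ... | inj₁ r           = k ⁺ , ⁺∈ω q , ⊆⁺ r , self∈⁺
    ... | inj₂ (inj₁ refl) = k ⁺ , ⁺∈ω q , self∈⁺ , self∈⁺
    ... | inj₂ (inj₂ r)    = j ⁺ , ⁺∈ω p , self∈⁺ , ⊆⁺ r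

    ⁺-cancel-∈ : k ∈ ω → j ⁺ ∈ k ⁺ → j ∈ k
    ⁺-cancel-∈ k∈ p with to ∈⁺ p
    ... | inj₁ q    = ∈-nat-trans k∈ self∈⁺ q
    ... | inj₂ refl = self∈⁺

  -- Closure properties of transitive models

  module Model {M : Class} (M-transitive : ∀ {x y} → M x → y ∈ x → M y)
               (M-zfc : Within.IsZFC M) where

    open Absoluteness M-transitive public
    private module Z = W.IsZFC M-zfc

    -- The set that `M` separates has the right elements, as `φ` is absolute and all elements of `a`
    -- are in `M`.
    sep-closed : (φ : BFormula (ℕ.suc n)) {ρ : Vec V n} → All M ρ → M a → M (sep φ ρ a)
    sep-closed {a = a} φ {ρ} ms ma with Z.separation ⌜ φ ⌝ ρ ms a ma
    ... | s , Ms , h = subst M (ext p q) Ms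
      where
        p : s ⊆ sep φ ρ a
        p u = let mu = M-transitive Ms u ; (v , t) = to (h _ mu) u in
              from (∈sep φ) (v , to (absolute φ (mu ∷ ms)) t)
        q : sep φ ρ a ⊆ s
        q u = let (v , t) = to (∈sep φ) u ; mu = M-transitive ma v in
              from (h _ mu) (v , from (absolute φ (mu ∷ ms)) t)

    pair-closed : M x → M y → M (pair x y)
    pair-closed mx my with Z.pairing _ mx _ my
    ... | z , mz , h = subst M (to (pair-absolute mz mx my) h) mz

    opair-closed : M x → M y → M ⟨ x , y ⟩
    opair-closed mx my = pair-closed (pair-closed mx mx) (pair-closed mx my)

    ⋃-closed : M x → M (⋃ x)
    ⋃-closed {x} mx with Z.union _ mx
    ... | u , mu , h = subst M (ext p q) mu
      where
        p : u ⊆ ⋃ x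
        p r = let (y , _ , s) = to (h _ (M-transitive mu r)) r in from ∈⋃ (y , s)
        q : ⋃ x ⊆ u
        q r with to ∈⋃ r
        ... | y , s , t = let my = M-transitive mx s in
                          from (h _ (M-transitive my t)) (y , my , s , t)

    ∪-closed : M x → M y → M (x ∪ y)
    ∪-closed mx my = ⋃-closed (pair-closed mx my)

    powersetᴹ : M x → ∃ λ p → M p × ∀ {z} → z ∈ p ⇔ (M z × z ⊆ x)
    powersetᴹ {x} mx with Z.powerset _ mx
    ... | p , mp , h = p , mp , λ {z} → mk⇔ (f z) (g z)
      where
        f : ∀ z → z ∈ p → M z × z ⊆ x
        f z u = let mz = M-transitive mp u in mz , λ v → to (h z mz) u _ (M-transitive mz v) v
        g : ∀ z → M z × z ⊆ x → z ∈ p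
        g z (mz , v) = from (h z mz) λ _ _ → v

    abstract
      -- The true power set that bounds `a ⊗ b` may be missing from `M`. The power sets taken in `M`
      -- still contain all the pairs, because `M` is closed under pairing, so they bound the same
      -- product.
      ⊗-closed : M a → M b → M (a ⊗ b)
      ⊗-closed {a} {b} ma mb with powersetᴹ (∪-closed ma mb)
      ... | p , mp , ∈p with powersetᴹ mp
      ... | q , mq , ∈q = subst M (ext f g) (sep-closed φ (ma ∷ mb ∷ []) mq)
        where
          φ : BFormula 3
          φ = ∃∈ v1 (∃∈ v3 (v2 ≡⟨ v1 , v0 ⟩ᶠ))
          f : sep φ (a ∷ b ∷ []) q ⊆ a ⊗ b
          f = from ∈⊗ ∘ proj₂ ∘ to (∈sep φ)
          pair∈ : x ∈ a ∪ b → y ∈ a ∪ b → pair x y ∈ p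
          pair∈ s t = from ∈p (pair-closed (M-transitive m s) (M-transitive m t) ,
            [ (λ { refl → s }) , (λ { refl → t }) ]′ ∘ to ∈pair)
            where
              m : M (a ∪ b)
              m = ∪-closed ma mb
          g : a ⊗ b ⊆ sep φ (a ∷ b ∷ []) q
          g u with to ∈⊗ u
          ... | x , s , y , t , refl = from (∈sep φ) (from ∈q
            (opair-closed (M-transitive ma s) (M-transitive mb t) ,
             [ (λ { refl → pair∈ s′ s′ }) , (λ { refl → pair∈ s′ t′ }) ]′ ∘ to ∈pair) ,
            x , s , y , t , refl)
            where
              s′ : x ∈ a ∪ b
              s′ = from ∈∪ (inj₁ s)
              t′ : y ∈ a ∪ b
              t′ = from ∈∪ (inj₂ t)

      graph-closed : (φ : BFormula (5 ℕ.+ n)) {ρ : Vec V n} → All M ρ → M a → M b →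
                     M (graph φ ρ a b)
      graph-closed φ ms ma mb = sep-closed _ (ma ∷ mb ∷ ms) (⊗-closed ma mb)

-- Binary expansions

module Bits {ℓ : Level} (em : ExcludedMiddle ℓ) (𝓥 : Structure ℓ)
            (zfc : SetTheory.ZFC 𝓥) where

  open Structure 𝓥 renaming (Carrier to V)
  open SetTheory 𝓥
  open Naturals em 𝓥 zfc public

  private variable
    e f i j k l m s x : V

  -- Exclusive or of digit `j` with the carry into it, which is what `lower` expresses.
  flipᶠ : (e l j : Fin n) → BFormula n
  flipᶠ e l j = ⟨ l , j ⟩∈ᶠ e ∧ᶠ ¬ᶠ lower ∨ᶠ ¬ᶠ ⟨ l , j ⟩∈ᶠ e ∧ᶠ lower
    where lower = ∀∈ j (⟨ suc l , v0 ⟩∈ᶠ suc e)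

  Flip : (e l j : V) → Set ℓ
  Flip e l j = ⟦ flipᶠ v0 v1 v2 ⟧ (e ∷ l ∷ j ∷ [])

  tableᶠ : (e k w o : Fin n) → BFormula n
  tableᶠ e k w o = ∀∈ w (¬ᶠ ⟨ suc o , v0 ⟩∈ᶠ suc e) ∧ᶠ
    ∀∈ k (∀∈ (suc w) (∀∈ (suc (suc w)) (v0 ≡ v2 ⁺ᶠ ⇒ᶠ
      (⟨ v0 , v1 ⟩∈ᶠ suc (suc (suc e)) ⇔ᶠ flipᶠ (suc (suc (suc e))) v2 v1))))

  -- The rows 0, …, k of e are the binary expansions of 0, …, k: the
  -- j-th digit flips from l to l + 1 iff all digits of l below j are 1.
  Table : (e k : V) → Set ℓ
  Table e k = ⟦ tableᶠ v0 v1 v2 v3 ⟧ (e ∷ k ∷ ω ∷ ∅ ∷ [])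

  SameRow : (e f l : V) → Set ℓ
  SameRow e f l = ∀ j → j ∈ ω → ⟨ l , j ⟩ ∈ e ⇔ ⟨ l , j ⟩ ∈ f

  table-suc : Table e k → l ∈ k → l ∈ ω → j ∈ ω → ⟨ l ⁺ , j ⟩ ∈ e ⇔ Flip e l j
  table-suc (_ , h) p q r = h _ p _ r _ (⁺∈ω q) refl

  table-⊆ : k ⊆ m → Table e m → Table e k
  table-⊆ p (z , h) = z , λ l q → h l (p q)

  flip-cong : SameRow e f l → j ∈ ω → Flip e l j → Flip f l j
  flip-cong h p (inj₁ (q , r)) = inj₁ (to (h _ p) q ,
    λ s → r λ i t → from (h i (ω-transitive _ p t)) (s i t))
  flip-cong h p (inj₂ (q , r)) = inj₂ (q ∘ from (h _ p) ,
    λ i t → to (h i (ω-transitive _ p t)) (r i t))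

  sameRow-sym : SameRow e f l → SameRow f e l
  sameRow-sym h j p = ⇔-sym (h j p)

  flip-cong⇔ : SameRow e f l → j ∈ ω → Flip e l j ⇔ Flip f l j
  flip-cong⇔ h p = mk⇔ (flip-cong h p) (flip-cong (sameRow-sym h) p)

  -- Induction on the row, each row being determined by the one before. The uniqueness lets finite
  -- tables be glued into `bits`, and it identifies the counter of a slice with that of the
  -- universe.
  tables-agree : k ∈ ω → m ∈ ω → Table e k → Table f m →
                 l ∈ ω → l ∈ k ⁺ → l ∈ m ⁺ → SameRow e f l
  tables-agree {k} {m} {e} {f} k∈ m∈ t u = ω-induction
    (v0 ∈ᶠ v3 ⇒ᶠ v0 ∈ᶠ v4 ⇒ᶠ ∀∈ v5 (⟨ v1 , v0 ⟩∈ᶠ v2 ⇔ᶠ ⟨ v1 , v0 ⟩∈ᶠ v3))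
    (e ∷ f ∷ k ⁺ ∷ m ⁺ ∷ ω ∷ [])
    (λ _ _ j p → mk⇔ (⊥-elim ∘ proj₁ t j p) (⊥-elim ∘ proj₁ u j p))
    (λ l∈ h p q j j∈ →
      let p′ = ⁺-cancel-∈ k∈ p ; q′ = ⁺-cancel-∈ m∈ q in
      ⇔-sym (table-suc u q′ l∈ j∈) ⇔-∘
        (flip-cong⇔ (h (⊆⁺ p′) (⊆⁺ q′)) j∈ ⇔-∘ table-suc t p′ l∈ j∈))

  IsBits : V → Set ℓ
  IsBits e = e ⊆ ω ⊗ ω × (∀ k → k ∈ ω → Table e k)

  bits-⊆ : IsBits e → IsBits f → e ⊆ f
  bits-⊆ (p , t) (q , u) r with to ∈⊗ (p r)
  ... | l , l∈ , j , j∈ , refl =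
    to (tables-agree l∈ l∈ (t l l∈) (u l l∈) l∈ self∈⁺ self∈⁺ j j∈) r

  -- The construction is relative to a transitive model so that its result belongs to the model. It
  -- is used twice: for `Universe`, giving `bits`, and for each slice, showing that `bits` lies
  -- there.
  module BitsIn {M : Class} (M-transitive : ∀ {x y} → M x → y ∈ x → M y)
                (M-zfc : Within.IsZFC M) (M-ω : M ω) where

    open Model M-transitive M-zfc

    private
      square = powersetᴹ (⊗-closed M-ω M-ω)

      Q : V
      Q = proj₁ square

      MQ : M Q
      MQ = proj₁ (proj₂ square)

      ∈Q : x ∈ Q ⇔ (M x × x ⊆ ω ⊗ ω)
      ∈Q = proj₂ (proj₂ square)

      M-∅ : M ∅
      M-∅ = M-transitive M-ω ∅∈ω

      -- Row `k ⁺` becomes the increment of row `k`; every other row of `f` is copied.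
      nextᶠ : BFormula 8
      nextᶠ = ¬ᶠ v1 ≡ᶠ v6 ∧ᶠ ⟨ v1 , v0 ⟩∈ᶠ v5 ∨ᶠ v1 ≡ᶠ v6 ∧ᶠ flipᶠ v5 v7 v0

      next : V → V → V
      next k f = graph nextᶠ (f ∷ k ⁺ ∷ k ∷ []) ω ω

      next-table : k ∈ ω → Table f k → Table (next k f) (k ⁺)
      next-table {k} {f} k∈ t = first , λ { l l∈ j j∈ _ _ refl → row l l∈ j j∈ }
        where
          first : ∀ j → j ∈ ω → ¬ ⟨ ∅ , j ⟩ ∈ next k f
          first j p q with to (∈graph nextᶠ) q
          ... | _ , _ , inj₁ (_ , r) = proj₁ t j p r
          ... | _ , _ , inj₂ (r , _) = ∉∅ (subst (k ∈_) (sym r) self∈⁺)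
          old : l ∈ ω → ¬ l ≡ k ⁺ → SameRow f (next k f) l
          old {l} p q j r = mk⇔ (λ s → from (∈graph nextᶠ) (p , r , inj₁ (q , s))) g
            where
              g : ⟨ l , j ⟩ ∈ next k f → ⟨ l , j ⟩ ∈ f
              g s with to (∈graph nextᶠ) s
              ... | _ , _ , inj₁ (_ , u) = u
              ... | _ , _ , inj₂ (u , _) = ⊥-elim (q u)
          new : j ∈ ω → ⟨ k ⁺ , j ⟩ ∈ next k f ⇔ Flip f k j
          new {j} p = mk⇔ g (λ s → from (∈graph nextᶠ) (⁺∈ω k∈ , p , inj₂ (refl , s)))
            where
              g : ⟨ k ⁺ , j ⟩ ∈ next k f → Flip f k j
              g s with to (∈graph nextᶠ) s
              ... | _ , _ , inj₁ (u , _) = ⊥-elim (u refl)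
              ... | _ , _ , inj₂ (_ , u) = u
          row : ∀ l → l ∈ k ⁺ → ∀ j → j ∈ ω → ⟨ l ⁺ , j ⟩ ∈ next k f ⇔ Flip (next k f) l j
          row l l∈ j j∈ with to ∈⁺ l∈
          ... | inj₂ refl = flip-cong⇔ (old k∈ λ r → ∈-irrefl (subst (l ∈_) (sym r) self∈⁺)) j∈
                            ⇔-∘ new j∈
          ... | inj₁ p = flip-cong⇔ (old l∈ω λ { refl → ∈-irrefl l∈ }) j∈ ⇔-∘
                         (table-suc t p l∈ω j∈ ⇔-∘
                          ⇔-sym (old (⁺∈ω l∈ω) (λ r → l≢k (⁺-injective r)) j j∈))
            where
              l∈ω = ω-transitive _ k∈ p
              l≢k : ¬ l ≡ k
              l≢k refl = ∈-irrefl p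

      table-exists : k ∈ ω → ∃ λ f → f ∈ Q × Table f k
      table-exists = ω-induction (∃∈ v1 (tableᶠ v0 v1 v3 v4)) (Q ∷ ω ∷ ∅ ∷ [])
        -- The empty relation is a table up to 0: the expansion of 0 has no digit 1.
        (∅ , from ∈Q (M-∅ , λ p → ⊥-elim (∉∅ p)) , (λ _ _ → ∉∅) , λ _ p → ⊥-elim (∉∅ p))
        step
        where
          step : k ∈ ω → (∃ λ f → f ∈ Q × Table f k) → ∃ λ f → f ∈ Q × Table f (k ⁺)
          step {k} k∈ (f , p , t) = next k f ,
            from ∈Q (graph-closed nextᶠ
              (proj₁ (to ∈Q p) ∷ M-transitive M-ω (⁺∈ω k∈) ∷ M-transitive M-ω k∈ ∷ [])
              M-ω M-ω , graph⊆⊗ nextᶠ) ,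
            next-table k∈ t

      tableOfᶠ : BFormula 7
      tableOfᶠ = ∃∈ v5 (tableᶠ v0 v2 v4 v7 ∧ᶠ ⟨ v2 , v1 ⟩∈ᶠ v0)

    abstract
      bits : V
      bits = graph tableOfᶠ (Q ∷ ∅ ∷ []) ω ω

      M-bits : M bits
      M-bits = graph-closed tableOfᶠ (MQ ∷ M-∅ ∷ []) M-ω M-ω

      bits-row : l ∈ ω → f ∈ Q → Table f l → SameRow bits f l
      bits-row {l} {f} p q t j j∈ = mk⇔ g
          (λ s → from (∈graph tableOfᶠ) (p , j∈ , f , q , t , s))
        where
          g : ⟨ l , j ⟩ ∈ bits → ⟨ l , j ⟩ ∈ f
          g s with to (∈graph tableOfᶠ) s
          ... | _ , _ , _ , _ , u , r =
            to (tables-agree p p u t p self∈⁺ self∈⁺ j j∈) r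

      bits-isBits : IsBits bits
      bits-isBits = graph⊆⊗ tableOfᶠ , table
        where
          table : ∀ k → k ∈ ω → Table bits k
          table k k∈ = first , λ { l p j j∈ _ _ refl → row (ω-transitive k k∈ p) j∈ }
            where
              first : ∀ j → j ∈ ω → ¬ ⟨ ∅ , j ⟩ ∈ bits
              first j p q with to (∈graph tableOfᶠ) q
              ... | _ , _ , _ , _ , u , r = proj₁ u j p r
              row : l ∈ ω → j ∈ ω → ⟨ l ⁺ , j ⟩ ∈ bits ⇔ Flip bits l j
              -- A single table up to `l ⁺` contains both rows, so its recursion clause carries over
              -- to `bits`.
              row p j∈ with table-exists (⁺∈ω p)
              ... | f , f∈ , t =
                ⇔-sym (flip-cong⇔ (bits-row p f∈ (table-⊆ ⊆⁺ t)) j∈) ⇔-∘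
                (table-suc t self∈⁺ p j∈ ⇔-∘ bits-row (⁺∈ω p) f∈ t _ j∈)

  open BitsIn {Universe} (λ _ _ → _) zfc _ public using (bits; bits-isBits)

  Bit : V → V → Set ℓ
  Bit k j = ⟨ k , j ⟩ ∈ bits

  bit-∈ω : Bit k j → k ∈ ω × j ∈ ω
  bit-∈ω p = to ⟨⟩∈⊗ (proj₁ bits-isBits p)

  ¬bit-zero : ¬ Bit ∅ j
  ¬bit-zero p = proj₁ (proj₂ bits-isBits ∅ ∅∈ω) _ (proj₂ (bit-∈ω p)) p

  bit-suc : k ∈ ω → j ∈ ω → Bit (k ⁺) j ⇔ Flip bits k j
  bit-suc p q = table-suc (proj₂ bits-isBits _ (⁺∈ω p)) self∈⁺ p q

  -- This is j < 2^j ≤ k, obtained without powers. If digit `j` of k + 1 is newly set, all digits of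
  -- k below `j` are 1; were k below `j`, then digit k of k would be 1, against the induction
  -- hypothesis.
  bit-< : Bit k j → j ∈ k
  bit-< p = let (k∈ , j∈) = bit-∈ω p in h k∈ _ j∈ p
    where
      step : k ∈ ω → (∀ j → j ∈ ω → Bit k j → j ∈ k) → ∀ j → j ∈ ω → Bit (k ⁺) j → j ∈ k ⁺
      step k∈ ih j j∈ p with to (bit-suc k∈ j∈) p
      ... | inj₁ (q , _) = ⊆⁺ (ih j j∈ q)
      ... | inj₂ (_ , q) with compare (nat-ord j∈) (nat-ord k∈)
      ... | inj₁ r           = ⊆⁺ r
      ... | inj₂ (inj₁ refl) = self∈⁺
      ... | inj₂ (inj₂ r)    = ⊥-elim (∈-irrefl (ih _ k∈ (q _ r)))
      h : k ∈ ω → ∀ j → j ∈ ω → Bit k j → j ∈ k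
      h = ω-induction (∀∈ v2 (⟨ v1 , v0 ⟩∈ᶠ v2 ⇒ᶠ v0 ∈ᶠ v1)) (bits ∷ ω ∷ [])
            (λ _ _ p → ⊥-elim (¬bit-zero p)) step

  Row : V → V → Set ℓ
  Row k s = ∀ j → j ∈ ω → Bit k j ⇔ j ∈ s

  private
    -- Counting on from k, whose digits below m are 0, reaches every s
    -- that agrees with k from m on.
    Reach : V → Set ℓ
    Reach m = ∀ k → k ∈ ω → ∀ s → s ∈ 𝒫 ω → (∀ j → j ∈ m → ¬ Bit k j) →
              (∀ j → j ∈ ω → j ∉ m → Bit k j ⇔ j ∈ s) → ∃ λ l → l ∈ ω × Row l s

    reachᶠ : BFormula 4
    reachᶠ = ∀∈ v1 (∀∈ v3 (∀∈ v2 (¬ᶠ ⟨ v2 , v0 ⟩∈ᶠ v6) ⇒ᶠ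
      ∀∈ v3 (¬ᶠ v0 ∈ᶠ v3 ⇒ᶠ (⟨ v2 , v0 ⟩∈ᶠ v6 ⇔ᶠ v0 ∈ᶠ v1)) ⇒ᶠ
      ∃∈ v3 (∀∈ v4 (⟨ v1 , v0 ⟩∈ᶠ v7 ⇔ᶠ v0 ∈ᶠ v2))))

    -- If `m ∉ s`, digit `m` is already right. Otherwise count first to the number `k′` that has all
    -- digits below `m` equal to 1 and otherwise those of `k`; one more step carries into digit `m`
    -- and clears the digits below, and from there `s` is reached. The hypothesis is used for two
    -- targets, so `Reach` quantifies over them.
    reach-suc : m ∈ ω → Reach m → Reach (m ⁺)
    reach-suc {m} m∈ ih k k∈ s s∈ low agree with em {m ∈ s}
    ... | no m∉s = ih k k∈ s s∈ (λ j p → low j (⊆⁺ p)) agree′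
      where
        agree′ : ∀ j → j ∈ ω → j ∉ m → Bit k j ⇔ j ∈ s
        agree′ j j∈ j∉ with em {j ∈ m ⁺}
        ... | no q  = agree j j∈ q
        ... | yes q with to ∈⁺ q
        ... | inj₁ r    = ⊥-elim (j∉ r)
        ... | inj₂ refl = mk⇔ (⊥-elim ∘ low m self∈⁺) (⊥-elim ∘ m∉s)
    ... | yes m∈s = ih (k′ ⁺) (⁺∈ω k′∈) s s∈ low′ agree′
      where
        fillᶠ : BFormula 4
        fillᶠ = v0 ∈ᶠ v1 ∨ᶠ ⟨ v2 , v0 ⟩∈ᶠ v3
        filled : V
        filled = sep fillᶠ (m ∷ k ∷ bits ∷ []) ω
        fill-agree : ∀ j → j ∈ ω → j ∉ m → Bit k j ⇔ j ∈ filled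
        fill-agree j j∈ j∉ = mk⇔ (λ p → from (∈sep fillᶠ) (j∈ , inj₂ p))
          (λ p → [ (λ q → ⊥-elim (j∉ q)) , id ]′ (proj₂ (to (∈sep fillᶠ) p)))
        reached : ∃ λ l → l ∈ ω × Row l filled
        reached = ih k k∈ filled (from ∈𝒫 (proj₁ ∘ to (∈sep fillᶠ)))
                     (λ j p → low j (⊆⁺ p)) fill-agree
        k′ : V
        k′ = proj₁ reached
        k′∈ : k′ ∈ ω
        k′∈ = proj₁ (proj₂ reached)
        row : Row k′ filled
        row = proj₂ (proj₂ reached)
        ones : j ∈ m → Bit k′ j
        ones p = from (row _ j∈) (from (∈sep fillᶠ) (j∈ , inj₁ p))
          where j∈ = ω-transitive _ m∈ p
        ¬bit-l-m : ¬ Bit k′ m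
        ¬bit-l-m p = low m self∈⁺ (from (fill-agree m m∈ ∈-irrefl) (to (row m m∈) p))
        low′ : ∀ j → j ∈ m → ¬ Bit (k′ ⁺) j
        low′ j p q with to (bit-suc k′∈ (ω-transitive _ m∈ p)) q
        ... | inj₁ (_ , r) = r λ i t → ones (∈-nat-trans m∈ t p)
        ... | inj₂ (r , _) = r (ones p)
        agree′ : ∀ j → j ∈ ω → j ∉ m → Bit (k′ ⁺) j ⇔ j ∈ s
        agree′ j j∈ j∉ with compare (nat-ord j∈) (nat-ord m∈)
        ... | inj₁ p           = ⊥-elim (j∉ p)
        ... | inj₂ (inj₁ refl) = mk⇔ (λ _ → m∈s)
          (λ _ → from (bit-suc k′∈ m∈) (inj₂ (¬bit-l-m , λ i → ones)))
        ... | inj₂ (inj₂ m∈j)  = agree j j∈ j∉⁺ ⇔-∘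
            (⇔-sym (fill-agree j j∈ j∉) ⇔-∘ (row j j∈ ⇔-∘ unflipped))
          where
            j∉⁺ : j ∉ m ⁺
            j∉⁺ q with to ∈⁺ q
            ... | inj₁ r    = j∉ r
            ... | inj₂ refl = ∈-irrefl m∈j
            unflip : Bit (k′ ⁺) j → Bit k′ j
            unflip p with to (bit-suc k′∈ j∈) p
            ... | inj₁ (q , _) = q
            ... | inj₂ (_ , q) = ⊥-elim (¬bit-l-m (q m m∈j))
            unflipped : Bit (k′ ⁺) j ⇔ Bit k′ j
            unflipped = mk⇔ unflip (λ p → from (bit-suc k′∈ j∈)
              (inj₁ (p , λ q → ¬bit-l-m (q m m∈j))))

  -- Counting starts at 0, which agrees with `s` from `m` on.
  row-exists : m ∈ ω → s ⊆ m → ∃ λ k → k ∈ ω × Row k s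
  row-exists m∈ s⊆ = ω-induction reachᶠ (ω ∷ 𝒫 ω ∷ bits ∷ [])
    (λ k k∈ s s∈ _ agree → k , k∈ , λ j j∈ → agree j j∈ ∉∅)
    reach-suc m∈ ∅ ∅∈ω _ (from ∈𝒫 (ω-transitive _ m∈ ∘ s⊆))
    (λ _ _ → ¬bit-zero) (λ j _ j∉ → mk⇔ (⊥-elim ∘ ¬bit-zero) (⊥-elim ∘ j∉ ∘ s⊆))

-- Codes for restrictions of reals, and finite sets of reals

module Forcing {ℓ : Level} (em : ExcludedMiddle ℓ) (𝓥 : Structure ℓ)
               (zfc : SetTheory.ZFC 𝓥) where

  open Structure 𝓥 renaming (Carrier to V)
  open SetTheory 𝓥
  open Bits em 𝓥 zfc public

  private variable
    i j k m x y z F : V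

  tokenᶠ : (i x m w e : Fin n) → BFormula n
  tokenᶠ i x m w e = ∀∈ w (⟨ suc i , v0 ⟩∈ᶠ suc e ⇔ᶠ
    v0 ∈ᶠ suc m ∧ᶠ v0 ∈ᶠ suc x ∨ᶠ v0 ≡ᶠ suc m)

  -- Row i is (x ∩ m) ∪ {m}, that is, i is a code for the restriction of x to m.
  Token : V → V → V → Set ℓ
  Token i x m = ⟦ tokenᶠ v0 v1 v2 v3 v4 ⟧ (i ∷ x ∷ m ∷ ω ∷ bits ∷ [])

  token-bit : m ∈ ω → Token i x m → Bit i m
  token-bit m∈ t = from (t _ m∈) (inj₂ refl)

  token-< : m ∈ ω → Token i x m → m ∈ i
  token-< m∈ t = bit-< (token-bit m∈ t)

  -- The length is the greatest position of a digit 1 in the code; this is the purpose of the marker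
  -- `m` in a token.
  token-length : m ∈ ω → k ∈ ω → Token i x m → Token i y k → m ≡ k
  token-length m∈ k∈ t u with to (u _ m∈) (token-bit m∈ t) | to (t _ k∈) (token-bit k∈ u)
  ... | inj₂ e       | _            = e
  ... | inj₁ _       | inj₂ e       = sym e
  ... | inj₁ (p , _) | inj₁ (q , _) = ⊥-elim (∈-asym p q)

  token-⊆ : m ∈ ω → Token i x m → Token i y m → j ∈ m → j ∈ x → j ∈ y
  token-⊆ m∈ t u p q
    with to (u _ (ω-transitive _ m∈ p)) (from (t _ (ω-transitive _ m∈ p)) (inj₁ (p , q)))
  ... | inj₁ (_ , r) = r
  ... | inj₂ refl    = ⊥-elim (∈-irrefl p)

  token-exists : ∀ x → m ∈ ω → ∃ λ i → i ∈ ω × Token i x m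
  token-exists {m} x m∈ with row-exists (⁺∈ω m∈) (proj₁ ∘ to (∈sep φ {ρ = m ∷ x ∷ []}))
    where
      φ : BFormula 3
      φ = v0 ∈ᶠ v1 ∧ᶠ v0 ∈ᶠ v2 ∨ᶠ v0 ≡ᶠ v1
  ... | i , i∈ , row = i , i∈ , λ j j∈ →
    mk⇔ (proj₂ ∘ to (∈sep _)) (λ p → from (∈sep _) (below p , p)) ⇔-∘ row j j∈
    where
      below : j ∈ m × j ∈ x ⊎ j ≡ m → j ∈ m ⁺
      below (inj₁ (p , _)) = ⊆⁺ p
      below (inj₂ refl)    = self∈⁺

  -- Every relation between F and ω that is total on F is bounded on F.  In
  -- the presence of choice this means that F is finite; closure under unions
  -- and the existence of uniform bounds are immediate from this form.
  boundedᶠ : BFormula 3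
  boundedᶠ = ∀∈ v1 (∀∈ v1 (∃∈ v4 (⟨ v1 , v0 ⟩∈ᶠ v2)) ⇒ᶠ
    ∃∈ v3 (∀∈ v2 (∃∈ v1 (⟨ v1 , v0 ⟩∈ᶠ v3))))

  abstract
    𝔽 : V
    𝔽 = sep boundedᶠ (𝒫 (𝒫 ω ⊗ ω) ∷ ω ∷ []) (𝒫 (𝒫 ω))

    ∈𝔽 : F ∈ 𝔽 ⇔ (F ∈ 𝒫 (𝒫 ω) × ⟦ boundedᶠ ⟧ (F ∷ 𝒫 (𝒫 ω ⊗ ω) ∷ ω ∷ []))
    ∈𝔽 = ∈sep boundedᶠ

  𝔽-real : F ∈ 𝔽 → x ∈ F → x ∈ 𝒫 ω
  𝔽-real F∈ = to ∈𝒫 (proj₁ (to ∈𝔽 F∈))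

  𝔽-singleton : x ∈ 𝒫 ω → ❴ x ❵ ∈ 𝔽
  𝔽-singleton {x} x∈ = from ∈𝔽 (from ∈𝒫 (λ p → subst (_∈ 𝒫 ω) (sym (∈❴❵ p)) x∈) , bd)
    where
      bd : ⟦ boundedᶠ ⟧ (❴ x ❵ ∷ 𝒫 (𝒫 ω ⊗ ω) ∷ ω ∷ [])
      bd g _ h with h x pair-left
      ... | k , k∈ , p = k ⁺ , ⁺∈ω k∈ , λ y q →
        k , self∈⁺ , subst (λ y → ⟨ y , k ⟩ ∈ g) (sym (∈❴❵ q)) p

  𝔽-∪ : ∀ {E} → E ∈ 𝔽 → F ∈ 𝔽 → E ∪ F ∈ 𝔽
  𝔽-∪ {F} {E} E∈ F∈ with to ∈𝔽 E∈ | to ∈𝔽 F∈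
  ... | E⊆ , bE | F⊆ , bF =
      from ∈𝔽 (from ∈𝒫 (λ p → [ to ∈𝒫 E⊆ , to ∈𝒫 F⊆ ]′ (to ∈∪ p)) , bd)
    where
      bd : ⟦ boundedᶠ ⟧ (E ∪ F ∷ 𝒫 (𝒫 ω ⊗ ω) ∷ ω ∷ [])
      bd g g∈ h with bE g g∈ (λ x p → h x (from ∈∪ (inj₁ p)))
                   | bF g g∈ (λ x p → h x (from ∈∪ (inj₂ p)))
      ... | j , j∈ , p | k , k∈ , q with ω-bound j∈ k∈
      ... | m , m∈ , j<m , k<m = m , m∈ , λ x r → combine x (to ∈∪ r)
        where
          combine : ∀ x → x ∈ E ⊎ x ∈ F → ∃ λ i → i ∈ m × ⟨ x , i ⟩ ∈ g
          combine x (inj₁ r) = let (i , s , t) = p x r in i , ∈-nat-trans m∈ s j<m , t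
          combine x (inj₂ r) = let (i , s , t) = q x r in i , ∈-nat-trans m∈ s k<m , t

  -- The form in which finiteness is used: pointwise witnesses in ω acquire a common bound.
  𝔽-bound : (φ : BFormula (5 ℕ.+ n)) {ρ : Vec V n} → F ∈ 𝔽 →
    (∀ x → x ∈ F → ∃ λ k → k ∈ ω × ⟦ φ ⟧ (k ∷ x ∷ ⟨ x , k ⟩ ∷ 𝒫 ω ∷ ω ∷ ρ)) →
    ∃ λ m → m ∈ ω ×
      (∀ x → x ∈ F → ∃ λ k → k ∈ m × ⟦ φ ⟧ (k ∷ x ∷ ⟨ x , k ⟩ ∷ 𝒫 ω ∷ ω ∷ ρ))
  𝔽-bound φ F∈ h with proj₂ (to ∈𝔽 F∈) (graph φ _ (𝒫 ω) ω) (from ∈𝒫 (graph⊆⊗ φ))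
    (λ x p → let (k , k∈ , q) = h x p in
             k , k∈ , from (∈graph φ) (𝔽-real F∈ p , k∈ , q))
  ... | m , m∈ , b = m , m∈ , λ x p → let (k , k< , q) = b x p in
                                      k , k< , proj₂ (proj₂ (to (∈graph φ) q))

  splitᶠ : (x y k : Fin n) → BFormula n
  splitᶠ x y k = x ≡ᶠ y ∨ᶠ ∃∈ k (¬ᶠ (v0 ∈ᶠ suc x ⇔ᶠ v0 ∈ᶠ suc y))

  Split : V → V → V → Set ℓ
  Split x y k = ⟦ splitᶠ v0 v1 v2 ⟧ (x ∷ y ∷ k ∷ [])

  split-⊆ : k ⊆ m → Split x y k → Split x y m
  split-⊆ h (inj₁ p)           = inj₁ p
  split-⊆ h (inj₂ (j , p , q)) = inj₂ (j , h p , q)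

  split-exists : x ∈ 𝒫 ω → y ∈ 𝒫 ω → ∃ λ k → k ∈ ω × Split x y k
  split-exists {x} {y} x∈ y∈ with em {∃ λ j → j ∈ ω × ¬ (j ∈ x ⇔ j ∈ y)}
  ... | yes (j , p , q) = j ⁺ , ⁺∈ω p , inj₂ (j , self∈⁺ , q)
  ... | no ¬diff = ∅ , ∅∈ω , inj₁ (ext (λ p → to (same (to ∈𝒫 x∈ p)) p)
                                       (λ p → from (same (to ∈𝒫 y∈ p)) p))
    where
      same : j ∈ ω → j ∈ x ⇔ j ∈ y
      same p = by-contradiction λ q → ¬diff (_ , p , q)

  -- Finiteness is applied twice, first to `x` for fixed `y`, then to `y`.
  split-level : F ∈ 𝔽 → ∃ λ k → k ∈ ω × ∀ x y → x ∈ F → y ∈ F → Split x y k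
  split-level {F} F∈ with 𝔽-bound (∀∈ v5 (splitᶠ v0 v2 v1)) {F ∷ []} F∈ splitOff
    where
      splitOff : ∀ y → y ∈ F → ∃ λ k → k ∈ ω × ∀ x → x ∈ F → Split x y k
      splitOff y y∈ with 𝔽-bound (splitᶠ v1 v5 v0) {y ∷ []} F∈
        (λ x x∈ → split-exists (𝔽-real F∈ x∈) (𝔽-real F∈ y∈))
      ... | m , m∈ , h = m , m∈ , λ x x∈ → let (k , k<m , s) = h x x∈ in
                                           split-⊆ (λ p → ∈-nat-trans m∈ p k<m) s
  ... | m , m∈ , h = m , m∈ , λ x y x∈ y∈ → let (k , k<m , s) = h y y∈ in
                              split-⊆ (λ p → ∈-nat-trans m∈ p k<m) (s x x∈)

  record IsRealMap (Y : V) : Set ℓ where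
    field
      ⊆⊗         : Y ⊆ 𝒫 ω ⊗ 𝒫 ω
      total      : x ∈ 𝒫 ω → ∃ λ y → ⟨ x , y ⟩ ∈ Y
      functional : ⟨ x , y ⟩ ∈ Y → ⟨ x , z ⟩ ∈ Y → y ≡ z

-- The order adds a set c ⊆ ω of codes such that, for every real x occurring in
-- the generic filter, the codes in c for restrictions x ∩ m have, from some point
-- on, an m that is itself a code for a restriction of Y(x), and arbitrarily long
-- restrictions of Y(x) occur in this way.
module Poset {ℓ : Level} (em : ExcludedMiddle ℓ) (𝓥 : Structure ℓ)
             (zfc : SetTheory.ZFC 𝓥) (Y : Structure.Carrier 𝓥)
             (Y-map : Forcing.IsRealMap em 𝓥 zfc Y) where

  open Structure 𝓥 renaming (Carrier to V)
  open SetTheory 𝓥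
  open Forcing em 𝓥 zfc public
  open IsRealMap Y-map

  private variable
    E F a b i j k l m p q r x y z : V

  codeᶠ : (m x l w e p f : Fin n) → BFormula n
  codeᶠ m x l w e p f =
    ∃∈ p (⟨ suc x , v0 ⟩∈ᶠ suc f ∧ᶠ tokenᶠ (suc m) v0 (suc l) (suc w) (suc e))

  Code : V → V → V → Set ℓ
  Code m x l = ∃ λ y → y ∈ 𝒫 ω × ⟨ x , y ⟩ ∈ Y × Token m y l

  safeᶠ hitᶠ : (k j x w e p f : Fin n) → BFormula n
  safeᶠ k j x w e p f = ∀∈ w (⟨ suc k , v0 ⟩∈ᶠ suc e ⇒ᶠ ¬ᶠ v0 ∈ᶠ suc j ⇒ᶠ
    ∀∈ (suc w) (tokenᶠ v1 (suc (suc x)) v0 (suc (suc w)) (suc (suc e)) ⇒ᶠ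
      ∃∈ (suc (suc w)) (codeᶠ v1 (suc (suc (suc x))) v0 (suc (suc (suc w)))
        (suc (suc (suc e))) (suc (suc (suc p))) (suc (suc (suc f))))))
  hitᶠ k j x w e p f = ∃∈ w (⟨ suc k , v0 ⟩∈ᶠ suc e ∧ᶠ ¬ᶠ v0 ∈ᶠ suc j ∧ᶠ
    ∃∈ (suc w) (tokenᶠ v1 (suc (suc x)) v0 (suc (suc w)) (suc (suc e)) ∧ᶠ
      ∃∈ (suc (suc w)) (suc (suc (suc j)) ∈ᶠ v0 ∧ᶠ
        codeᶠ v1 (suc (suc (suc x))) v0 (suc (suc (suc w)))
          (suc (suc (suc e))) (suc (suc (suc p))) (suc (suc (suc f))))))

  -- Both concern the elements that `k` adds from `j` on. `Safe` admits no misleading code for `x`,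
  -- so that nothing wrong is decoded; `Hit` supplies a restriction of Y(x) longer than `j`, so that
  -- everything is decoded eventually.
  Safe Hit : V → V → V → Set ℓ
  Safe k j x = ∀ i → i ∈ ω → Bit k i → i ∉ j → ∀ m → m ∈ ω → Token i x m →
               ∃ λ l → l ∈ ω × Code m x l
  Hit k j x = ∃ λ i → i ∈ ω × Bit k i × i ∉ j × ∃ λ m → m ∈ ω × Token i x m ×
              ∃ λ l → l ∈ ω × j ∈ l × Code m x l

  extendsᶠ : (k E j F w e p f : Fin n) → BFormula n
  extendsᶠ k E j F w e p f = ∀∈ F (v0 ∈ᶠ suc E) ∧ᶠ (k ≡ᶠ j ∨ᶠ j ∈ᶠ k ∧ᶠ
    ∀∈ j (⟨ suc k , v0 ⟩∈ᶠ suc e ⇔ᶠ ⟨ suc j , v0 ⟩∈ᶠ suc e) ∧ᶠ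
    ∀∈ F (safeᶠ (suc k) (suc j) v0 (suc w) (suc e) (suc p) (suc f) ∧ᶠ
          hitᶠ (suc k) (suc j) v0 (suc w) (suc e) (suc p) (suc f)))

  -- End-extension of finite sets: by `bit-<` the set coded by `j` lies below `j`, so agreement is
  -- required exactly there.
  Longer : (k j F : V) → Set ℓ
  Longer k j F = j ∈ k × (∀ i → i ∈ j → Bit k i ⇔ Bit j i) ×
                 (∀ x → x ∈ F → Safe k j x × Hit k j x)

  Extends : (k E j F : V) → Set ℓ
  Extends k E j F = (∀ x → x ∈ F → x ∈ E) × (k ≡ j ⊎ Longer k j F)

  leᶠ : BFormula 10
  leᶠ = ∃∈ v5 (∃∈ v10 (v3 ≡⟨ v1 , v0 ⟩ᶠ ∧ᶠ ∃∈ v7 (∃∈ v12 (v4 ≡⟨ v1 , v0 ⟩ᶠ ∧ᶠ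
    extendsᶠ v3 v2 v1 v0 v9 v10 v11 v12))))

  abstract
    P R : V
    P = ω ⊗ 𝔽
    R = graph leᶠ (ω ∷ bits ∷ 𝒫 ω ∷ Y ∷ 𝔽 ∷ []) P P

    ∈P : z ∈ P ⇔ (∃ λ k → k ∈ ω × ∃ λ F → F ∈ 𝔽 × z ≡ ⟨ k , F ⟩)
    ∈P = ∈⊗

    ⟨⟩∈P : ⟨ k , F ⟩ ∈ P ⇔ (k ∈ ω × F ∈ 𝔽)
    ⟨⟩∈P = ⟨⟩∈⊗

    R⊆ : R ⊆ P ⊗ P
    R⊆ = graph⊆⊗ leᶠ

    ∈R : ⟨ ⟨ k , E ⟩ , ⟨ j , F ⟩ ⟩ ∈ R ⇔ (k ∈ ω × E ∈ 𝔽 × j ∈ ω × F ∈ 𝔽 × Extends k E j F)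
    ∈R {k} {E} {j} {F} = mk⇔ f g
      where
        f : ⟨ ⟨ k , E ⟩ , ⟨ j , F ⟩ ⟩ ∈ R → k ∈ ω × E ∈ 𝔽 × j ∈ ω × F ∈ 𝔽 × Extends k E j F
        f h with to (∈graph leᶠ) h
        ... | _ , _ , k′ , k∈ , E′ , E∈ , e , j′ , j∈ , F′ , F∈ , e′ , s
          with ⟨⟩-injective e | ⟨⟩-injective e′
        ... | refl , refl | refl , refl = k∈ , E∈ , j∈ , F∈ , s
        g : k ∈ ω × E ∈ 𝔽 × j ∈ ω × F ∈ 𝔽 × Extends k E j F →
            ⟨ ⟨ k , E ⟩ , ⟨ j , F ⟩ ⟩ ∈ R
        g (k∈ , E∈ , j∈ , F∈ , s) = from (∈graph leᶠ)
          (from ⟨⟩∈P (k∈ , E∈) , from ⟨⟩∈P (j∈ , F∈) ,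
           _ , k∈ , _ , E∈ , refl , _ , j∈ , _ , F∈ , refl , s)

  -- An element of `k` from `i` on lies below `j`, where the promise of `j` over `i` applies, or
  -- from `j` on, where that of `k` over `j` applies to all of `F₀ ⊆ F₁`. The hit is inherited from
  -- `j`.
  extends-trans : ∀ {F₀ F₁ F₂} → k ∈ ω → Extends k F₂ j F₁ → Extends j F₁ i F₀ →
                  Extends k F₂ i F₀
  extends-trans {k} {j} {i} {F₀} {F₁} k∈ (s , a) (t , b) = (λ x → s x ∘ t x) , compose a b
    where
      compose : k ≡ j ⊎ Longer k j F₁ → j ≡ i ⊎ Longer j i F₀ → k ≡ i ⊎ Longer k i F₀
      compose (inj₁ refl) b           = b
      compose (inj₂ (p , q , h)) (inj₁ refl) = inj₂ (p , q , λ x → h x ∘ t x)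
      compose (inj₂ (p , q , h)) (inj₂ (p′ , q′ , h′)) = inj₂ (∈-nat-trans k∈ p′ p ,
          (λ u u∈ → q′ u u∈ ⇔-∘ q u (u<j u∈)) , λ x x∈ → safe x x∈ , hit x x∈)
        where
          u<j : x ∈ i → x ∈ j
          u<j u∈ = ∈-nat-trans (ω-transitive _ k∈ p) u∈ p′
          safe : ∀ x → x ∈ F₀ → Safe k i x
          safe x x∈ u u∈ bit u∉ with em {u ∈ j}
          ... | yes u<j = proj₁ (h′ x x∈) u u∈ (to (q u u<j) bit) u∉
          ... | no u≮j  = proj₁ (h x (t x x∈)) u u∈ bit u≮j
          hit : ∀ x → x ∈ F₀ → Hit k i x
          hit x x∈ with proj₂ (h′ x x∈)
          ... | u , u∈ , bit , rest = u , u∈ , from (q u (bit-< bit)) bit , rest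

  extends-antisym : k ∈ ω → Extends k E j F → Extends j F k E → k ≡ j × E ≡ F
  extends-antisym {k} {E} {j} {F} k∈ (s , a) (t , b) =
      level a b , ext (λ p → t _ p) (λ p → s _ p)
    where
      level : k ≡ j ⊎ Longer k j F → j ≡ k ⊎ Longer j k E → k ≡ j
      level (inj₁ e) _ = e
      level (inj₂ _) (inj₁ e) = sym e
      level (inj₂ (p , _)) (inj₂ (q , _)) = ⊥-elim (∈-asym p q)

  infix 4 _≤P_
  _≤P_ : V → V → Set ℓ
  p ≤P q = ⟨ p , q ⟩ ∈ R

  ≤P-∈P : p ≤P q → p ∈ P × q ∈ P
  ≤P-∈P h = to ⟨⟩∈⊗ (R⊆ h)

  abstract
    ≤-trans : p ≤P q → q ≤P r → p ≤P r
    ≤-trans h h′ with to ∈P (proj₁ (≤P-∈P h)) | to ∈P (proj₂ (≤P-∈P h))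
                    | to ∈P (proj₂ (≤P-∈P h′))
    ... | _ , _ , _ , _ , refl | _ , _ , _ , _ , refl | _ , _ , _ , _ , refl
      with to ∈R h | to ∈R h′
    ... | k∈ , E∈ , _ , _ , s | _ , _ , i∈ , F∈ , s′ =
      from ∈R (k∈ , E∈ , i∈ , F∈ , extends-trans k∈ s s′)

  isPartialOrder : IsPartialOrder P R
  isPartialOrder = record
    { nonempty = ⟨ ∅ , ❴ ∅ ❵ ⟩ , _ ,
                 from ⟨⟩∈P (∅∈ω , 𝔽-singleton (from ∈𝒫 λ p → ⊥-elim (∉∅ p)))
    ; relation = relation⁺ R⊆
    ; reflexive = λ p h → from related (≤-refl h)
    ; antisymmetric = λ p q h h′ → ≤-antisym (to related h) (to related h′)
    ; transitive = λ p q r h h′ → from related (≤-trans (to related h) (to related h′))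
    }
    where
      ≤-refl : p ∈ P → p ≤P p
      ≤-refl h with to ∈P h
      ... | _ , k∈ , _ , F∈ , refl = from ∈R (k∈ , F∈ , k∈ , F∈ , (λ _ → id) , inj₁ refl)
      ≤-antisym : p ≤P q → q ≤P p → p ≡ q
      ≤-antisym h h′ with to ∈P (proj₁ (≤P-∈P h)) | to ∈P (proj₂ (≤P-∈P h))
      ... | _ , _ , _ , _ , refl | _ , _ , _ , _ , refl with to ∈R h | to ∈R h′
      ... | k∈ , _ , _ , _ , s | _ , _ , _ , _ , s′ with extends-antisym k∈ s s′
      ... | e , e′ = cong₂ ⟨_,_⟩ e e′

  -- The order is σ-centred

  levelᶠ : (p k f : Fin n) → BFormula n
  levelᶠ p k f = ∃∈ f (suc p ≡⟨ suc k , v0 ⟩ᶠ)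

  level : V → V
  level k = sep (levelᶠ v0 v1 v2) (k ∷ 𝔽 ∷ []) P

  ∈level : z ∈ level k ⇔ (z ∈ P × ∃ λ F → F ∈ 𝔽 × z ≡ ⟨ k , F ⟩)
  ∈level = ∈sep (levelᶠ v0 v1 v2)

  -- With `k` kept, nothing is added to c and there is no promise to check. Centredness of a level
  -- rests on this.
  level-extends : k ∈ ω → E ∈ 𝔽 → F ∈ 𝔽 → F ⊆ E → ⟨ k , E ⟩ ≤P ⟨ k , F ⟩
  level-extends k∈ E∈ F∈ h = from ∈R (k∈ , E∈ , k∈ , F∈ , (λ _ → h) , inj₁ refl)

  private
    bounded-belowᶠ : BFormula 5
    bounded-belowᶠ = ∀∈ v1 (∀∈ v0 (∃∈ v2 (⟨ v1 , v0 ⟩∈ᶠ v5)) ⇒ᶠ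
      ∃∈ v4 (∀∈ v1 (⟨ v1 , v0 ⟩∈ᶠ v7)))

    -- Finiteness of `a` comes as an injection `g` into a number, so the induction is on a bound `j`
    -- for the values of `g`. The subset `x` varies because the step removes the element with value
    -- `j`.
    BoundedBelow : (a g k j : V) → Set ℓ
    BoundedBelow a g k j = ∀ x → x ∈ 𝒫 a → (∀ z → z ∈ x → ∃ λ i → i ∈ j × ⟨ z , i ⟩ ∈ g) →
      ∃ λ q → q ∈ level k × (∀ p → p ∈ x → q ≤P p)

    bounded-below-zero : k ∈ ω → BoundedBelow a b k ∅
    -- Here `x` is empty, so any condition of the level will do; its finite part is `❴ ∅ ❵`.
    bounded-below-zero k∈ x _ h = _ ,
      from ∈level (from ⟨⟩∈P (k∈ , F∈) , _ , F∈ , refl) ,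
      λ p p∈ → ⊥-elim (∉∅ (proj₁ (proj₂ (h p p∈))))
      where
        F∈ : ❴ ∅ ❵ ∈ 𝔽
        F∈ = 𝔽-singleton (from ∈𝒫 λ p → ⊥-elim (∉∅ p))

    -- By injectivity at most one `b ∈ x` has value `j`. Its finite part is united with that of a
    -- lower bound for the rest.
    bounded-below-suc : ∀ {g} → k ∈ ω → a ⊆ level k →
      (∀ {x y i} → ⟨ x , i ⟩ ∈ g → ⟨ y , i ⟩ ∈ g → x ≡ y) →
      BoundedBelow a g k j → BoundedBelow a g k (j ⁺)
    bounded-below-suc {k} {a} {j} {g} k∈ a⊆ inj ih x x∈ h
      with em {∃ λ b → b ∈ x × ⟨ b , j ⟩ ∈ g}
    ... | no none = ih x x∈ h′
      where
        h′ : ∀ z → z ∈ x → ∃ λ i → i ∈ j × ⟨ z , i ⟩ ∈ g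
        h′ z z∈ with h z z∈
        ... | i , i∈ , q with to ∈⁺ i∈
        ... | inj₁ i<j  = i , i<j , q
        ... | inj₂ refl = ⊥-elim (none (z , z∈ , q))
    ... | yes (b , b∈ , bj) = extend (ih x′ x′∈ h′)
      where
        othersᶠ : BFormula 2
        othersᶠ = ¬ᶠ v0 ≡ᶠ v1
        x′ : V
        x′ = sep othersᶠ (b ∷ []) x
        x′∈ : x′ ∈ 𝒫 a
        x′∈ = from ∈𝒫 (to ∈𝒫 x∈ ∘ proj₁ ∘ to (∈sep othersᶠ))
        h′ : ∀ z → z ∈ x′ → ∃ λ i → i ∈ j × ⟨ z , i ⟩ ∈ g
        h′ z z∈ with to (∈sep othersᶠ) z∈
        ... | z∈x , z≢b with h z z∈x
        ... | i , i∈ , q with to ∈⁺ i∈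
        ... | inj₁ i<j  = i , i<j , q
        ... | inj₂ refl = ⊥-elim (z≢b (inj q bj))
        extend : (∃ λ q → q ∈ level k × (∀ p → p ∈ x′ → q ≤P p)) →
                 ∃ λ q → q ∈ level k × (∀ p → p ∈ x → q ≤P p)
        extend (q , q∈ , below) with to ∈level q∈ | to ∈level (a⊆ (to ∈𝒫 x∈ b∈))
        ... | _ , E , E∈ , refl | _ , F , F∈ , refl =
            ⟨ k , E ∪ F ⟩ , from ∈level (from ⟨⟩∈P (k∈ , EF∈) , _ , EF∈ , refl) , below′
          where
            EF∈ : E ∪ F ∈ 𝔽
            EF∈ = 𝔽-∪ E∈ F∈
            below′ : ∀ p → p ∈ x → ⟨ k , E ∪ F ⟩ ≤P p
            below′ p p∈ with em {p ≡ ⟨ k , F ⟩}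
            ... | yes refl = level-extends k∈ EF∈ F∈ (λ u → from ∈∪ (inj₂ u))
            ... | no p≢b   = ≤-trans (level-extends k∈ EF∈ E∈ (λ u → from ∈∪ (inj₁ u)))
                                     (below p (from (∈sep othersᶠ) (p∈ , p≢b)))

  level-centred : k ∈ ω → IsCentred P R (level k)
  level-centred {k} k∈ = (λ _ _ p → proj₁ (to ∈level p)) , bound
    where
      bound : ∀ a → a U.⊆ level k → U.Finite a →
              ∃ λ q → q ∈ P × (∀ p → p ∈ a → U.Related R q p)
      bound a a⊆ (w , _ , isω , n , _ , n∈ , g , _ , (rel , tot , _) , inj) =
        let (q , q∈ , below) = bounded-below n∈′ a (from ∈𝒫 id) total′ in
        q , proj₁ (to ∈level q∈) , λ p p∈ → from related (below p p∈)
        where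
          n∈′ : n ∈ ω
          n∈′ = subst (n ∈_) (isOmega-unique isω) n∈
          bounded-below : j ∈ ω → BoundedBelow a g k j
          bounded-below = ω-induction bounded-belowᶠ (𝒫 a ∷ g ∷ level k ∷ R ∷ [])
            (bounded-below-zero k∈)
            (λ _ → bounded-below-suc k∈ (λ p → a⊆ _ _ p)
              (λ p q → inj _ _ _ _ _ _ (from related p) (from related q)))
          total′ : ∀ z → z ∈ a → ∃ λ i → i ∈ n × ⟨ z , i ⟩ ∈ g
          total′ z z∈ = let (i , _ , r) = tot z _ z∈ ; p = to related r in
                        i , proj₂ (to ⟨⟩∈⊗ (relation⁻ rel p)) , p

  levels-function : ∃ λ c → U.IsFunction c ω (𝒫 P) ×
                    (∀ {k A} → ⟨ k , A ⟩ ∈ c ⇔ (k ∈ ω × A ≡ level k))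
  levels-function = _ , function-graph (∀∈ v5 (v0 ∈ᶠ v1 ⇔ᶠ levelᶠ v0 v2 v7)) (P ∷ 𝔽 ∷ [])
    level (λ _ → from ∈𝒫 (proj₁ ∘ to ∈level)) (λ _ A∈ → ≡sep _ A∈)

  isσCentred : IsσCentred P R
  isσCentred = let (c , isFun , ∈c) = levels-function in
    ω , 𝒫 P , c , ω-isOmega , isFun ,
    (λ n A r → let (n∈ , e) = to ∈c (to related r) in
               subst (IsCentred P R) (sym e) (level-centred n∈)) ,
    λ p p∈ → let (k , k∈ , F , F∈ , e) = to ∈P p∈ in
             k , level k , from related (from ∈c (k∈ , refl)) ,
             from ∈level (p∈ , F , F∈ , e)

-- Density

module Generic {ℓ : Level} (em : ExcludedMiddle ℓ) (𝓥 : Structure ℓ)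
               (zfc : SetTheory.ZFC 𝓥) (Y : Structure.Carrier 𝓥)
               (Y-map : Forcing.IsRealMap em 𝓥 zfc Y) where

  open Structure 𝓥 renaming (Carrier to V)
  open SetTheory 𝓥
  open Poset em 𝓥 zfc Y Y-map public
  open IsRealMap Y-map

  private variable
    C D F G N a i j k l m p q x y : V

  codingᶠ : (i x l w e p f : Fin n) → BFormula n
  codingᶠ i x l w e p f = ∃∈ w (tokenᶠ (suc i) (suc x) v0 (suc w) (suc e) ∧ᶠ
    codeᶠ v0 (suc x) (suc l) (suc w) (suc e) (suc p) (suc f))

  Coding : V → V → V → Set ℓ
  Coding i x l = ∃ λ m → m ∈ ω × Token i x m × Code m x l

  code-exists : x ∈ 𝒫 ω → l ∈ ω → ∃ λ m → m ∈ ω × Code m x l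
  code-exists x∈ l∈ with total x∈
  ... | y , xy with token-exists y l∈
  ... | m , m∈ , t = m , m∈ , y , proj₂ (to ⟨⟩∈⊗ (⊆⊗ xy)) , xy , t

  code-< : l ∈ ω → Code m x l → l ∈ m
  code-< l∈ (_ , _ , _ , t) = token-< l∈ t

  coding-exists : x ∈ 𝒫 ω → l ∈ ω → ∃ λ i → i ∈ ω × Coding i x l
  coding-exists {x} x∈ l∈ with code-exists x∈ l∈
  ... | m , m∈ , c with token-exists x m∈
  ... | i , i∈ , t = i , i∈ , m , m∈ , t , c

  -- Both codes exceed the lengths they encode. A large `l` therefore forces every new element of c
  -- beyond any prescribed number.
  coding-< : i ∈ ω → l ∈ ω → Coding i x l → l ∈ i
  coding-< i∈ l∈ (m , m∈ , t , c) = ∈-nat-trans i∈ (code-< l∈ c) (token-< m∈ t)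

  coding-bound : F ∈ 𝔽 → l ∈ ω →
                 ∃ λ m → m ∈ ω × (∀ x → x ∈ F → ∃ λ i → i ∈ m × Coding i x l)
  coding-bound F∈ l∈ = 𝔽-bound (codingᶠ v0 v1 v5 v4 v6 v3 v7) {_ ∷ bits ∷ Y ∷ []} F∈
    (λ x x∈ → coding-exists (𝔽-real F∈ x∈) l∈)

  abstract
    -- Beyond a level l at which the elements of F split, a code for a
    -- restriction of one of them is not a code for a restriction of another.
    lengthen : k ∈ ω → F ∈ 𝔽 → a ∈ F → j ∈ ω →
               ∃ λ m → m ∈ ω × j ∈ m × Extends m F k F
    lengthen {k} {F} {a} {j} k∈ F∈ a∈ j∈ with split-level F∈
    -- The length `l` is chosen beyond `k`, `j` and the splitting level `s`. Each element of `F` has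
    -- a code for `l` below `b`, and `c` bounds the old set together with the new codes.
    ... | s , s∈ , split with ω-bound k∈ j∈
    ... | l₀ , l₀∈ , k<l₀ , j<l₀ with ω-bound l₀∈ s∈
    ... | l , l∈ , l₀<l , s<l with coding-bound F∈ l∈
    ... | b , b∈ , bound with ω-bound k∈ b∈
    ... | c , c∈ , k<c , b<c = finish (row-exists c∈ new⊆)
      where
        newᶠ : BFormula 9
        newᶠ = ⟨ v1 , v0 ⟩∈ᶠ v2 ∨ᶠ v0 ∈ᶠ v3 ∧ᶠ ∃∈ v4 (codingᶠ v1 v0 v6 v7 v3 v8 v9)
        new : V
        new = sep newᶠ (k ∷ bits ∷ b ∷ F ∷ l ∷ ω ∷ 𝒫 ω ∷ Y ∷ []) ω
        ∈new : i ∈ new ⇔ (i ∈ ω × (Bit k i ⊎ i ∈ b × ∃ λ x → x ∈ F × Coding i x l))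
        ∈new = ∈sep newᶠ
        new⊆ : new ⊆ c
        new⊆ p with to ∈new p
        ... | _ , inj₁ bit      = ∈-nat-trans c∈ (bit-< bit) k<c
        ... | _ , inj₂ (q , _)  = ∈-nat-trans c∈ q b<c
        l₀<coding : i ∈ ω → Coding i x l → l₀ ∈ i
        l₀<coding i∈ c = ∈-nat-trans i∈ l₀<l (coding-< i∈ l∈ c)
        k<coding : i ∈ ω → Coding i x l → k ∈ i
        k<coding i∈ c = ∈-nat-trans i∈ k<l₀ (l₀<coding i∈ c)
        finish : (∃ λ m → m ∈ ω × Row m new) → ∃ λ m → m ∈ ω × j ∈ m × Extends m F k F
        finish (m , m∈ , row) = m , m∈ , proj₂ k,j<m , (λ _ → id) ,
            inj₂ (proj₁ k,j<m , coherent , λ x x∈ → safe x x∈ , hit x x∈)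
          where
            coded : ∀ x → x ∈ F → ∃ λ i → i ∈ ω × Bit m i × Coding i x l
            coded x x∈ with bound x x∈
            ... | i , i<b , cd = i , i∈ , from (row i i∈)
                (from ∈new (i∈ , inj₂ (i<b , x , x∈ , cd))) , cd
              where
                i∈ : i ∈ ω
                i∈ = ω-transitive _ b∈ i<b
            -- A number exceeds the positions of its digits 1, and the code for `a` is such a
            -- position beyond `k` and `j`.
            k,j<m : k ∈ m × j ∈ m
            k,j<m with coded a a∈
            ... | i , i∈ , bit , cd = ∈-nat-trans m∈ (k<coding i∈ cd) (bit-< bit) ,
              ∈-nat-trans m∈ (∈-nat-trans i∈ j<l₀ (l₀<coding i∈ cd)) (bit-< bit)
            coherent : ∀ i → i ∈ k → Bit m i ⇔ Bit k i
            coherent i i<k = mk⇔ f λ bit → from (row i i∈) (from ∈new (i∈ , inj₁ bit))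
              where
                i∈ : i ∈ ω
                i∈ = ω-transitive _ k∈ i<k
                f : Bit m i → Bit k i
                f bit with to ∈new (to (row i i∈) bit)
                ... | _ , inj₁ r                = r
                ... | _ , inj₂ (_ , _ , _ , cd) = ⊥-elim (∈-asym i<k (k<coding i∈ cd))
            hit : ∀ x → x ∈ F → Hit m k x
            hit x x∈ with coded x x∈
            ... | i , i∈ , bit , n , n∈ , t , cd = i , i∈ , bit ,
              (λ i<k → ∈-asym i<k (k<coding i∈ (n , n∈ , t , cd))) ,
              n , n∈ , t , l , l∈ , ∈-nat-trans l∈ k<l₀ l₀<l , cd
            safe : ∀ x → x ∈ F → Safe m k x
            safe x x∈ i i∈ bit i≮k n n∈ t with to ∈new (to (row i i∈) bit)
            ... | _ , inj₁ r = ⊥-elim (i≮k (bit-< r))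
            ... | _ , inj₂ (_ , x′ , x′∈ , n′ , n′∈ , t′ , cd)
              with token-length n∈ n′∈ t t′ | split x x′ x∈ x′∈
            ... | refl | inj₁ refl = l , l∈ , cd
            ... | refl | inj₂ (d , d<s , differ) =
                ⊥-elim (differ (mk⇔ (token-⊆ n∈ t t′ d<n) (token-⊆ n∈ t′ t d<n)))
              where
                d<n : d ∈ n
                d<n = ∈-nat-trans n∈ (∈-nat-trans l∈ d<s s<l) (code-< l∈ cd)

  densePartᶠ : (p a w f N : Fin n) → BFormula n
  densePartᶠ p a w f N = ∃∈ w (∃∈ (suc f) (suc (suc p) ≡⟨ v1 , v0 ⟩ᶠ ∧ᶠ
    ∃∈ v0 (¬ᶠ ⟨ suc (suc (suc a)) , v0 ⟩∈ᶠ suc (suc (suc N))) ∧ᶠ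
    (suc (suc a) ∈ᶠ suc (suc w) ⇒ᶠ suc (suc a) ∈ᶠ v1)))

  -- One index carries two demands: a real outside the section of `N` at `a`, and, if `a` is a
  -- natural number, a level beyond `a`. A family indexed by ω₁ ⊇ ω thus covers both.
  densePart : (N a : V) → V
  densePart N a = sep (densePartᶠ v0 v1 v2 v3 v4) (a ∷ ω ∷ 𝔽 ∷ N ∷ []) P

  ∈densePart : p ∈ densePart N a ⇔ (p ∈ P × ∃ λ k → k ∈ ω × ∃ λ F → F ∈ 𝔽 ×
    p ≡ ⟨ k , F ⟩ × (∃ λ x → x ∈ F × ¬ ⟨ a , x ⟩ ∈ N) × (a ∈ ω → a ∈ k))
  ∈densePart = ∈sep (densePartᶠ v0 v1 v2 v3 v4)

  densePart-dense : (∃ λ x → x ∈ 𝒫 ω × ¬ ⟨ a , x ⟩ ∈ N) → IsDense P R (densePart N a)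
  densePart-dense {a} {N} (x , x∈ , ax∉) = (λ _ _ → proj₁ ∘ to ∈densePart) , dense
    where
      dense : ∀ p → p ∈ P → ∃ λ q → q ∈ densePart N a × U.Related R q p
      dense p p∈ with to ∈P p∈
      ... | k , k∈ , F , F∈ , refl = addLevel (em {a ∈ ω})
        where
          E : V
          E = F ∪ ❴ x ❵
          E∈ : E ∈ 𝔽
          E∈ = 𝔽-∪ F∈ (𝔽-singleton x∈)
          x∈E : x ∈ E
          x∈E = from ∈∪ (inj₂ pair-left)
          addReal : ⟨ k , E ⟩ ≤P ⟨ k , F ⟩
          addReal = level-extends k∈ E∈ F∈ (λ u → from ∈∪ (inj₁ u))
          addLevel : Dec (a ∈ ω) → ∃ λ q → q ∈ densePart N a × U.Related R q p
          addLevel (no a∉ω) = ⟨ k , E ⟩ , from ∈densePart (from ⟨⟩∈P (k∈ , E∈) ,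
            k , k∈ , E , E∈ , refl , (x , x∈E , ax∉) , λ q → ⊥-elim (a∉ω q)) ,
            from related addReal
          addLevel (yes a∈ω) with lengthen k∈ E∈ x∈E a∈ω
          ... | m , m∈ , a<m , extends = ⟨ m , E ⟩ , from ∈densePart (from ⟨⟩∈P (m∈ , E∈) ,
            m , m∈ , E , E∈ , refl , (x , x∈E , ax∉) , λ _ → a<m) ,
            from related (≤-trans (from ∈R (m∈ , E∈ , k∈ , E∈ , extends)) addReal)

  denseParts-function : ∀ N a → ∃ λ d → U.IsFunction d a (𝒫 P) ×
                        (∀ {b D} → ⟨ b , D ⟩ ∈ d ⇔ (b ∈ a × D ≡ densePart N b))
  denseParts-function N a = _ , function-graph
    (∀∈ v5 (v0 ∈ᶠ v1 ⇔ᶠ densePartᶠ v0 v2 v7 v8 v9)) (P ∷ ω ∷ 𝔽 ∷ N ∷ [])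
    (densePart N) (λ _ → from ∈𝒫 (proj₁ ∘ to ∈densePart)) (λ _ D∈ → ≡sep _ D∈)

  -- Decoding

  decodeᶠ : BFormula 6
  decodeᶠ = ∃∈ v1 (¬ᶠ v0 ∈ᶠ v4 ∧ᶠ ∃∈ v5 (tokenᶠ v1 v4 v0 v6 v7 ∧ᶠ
    ⟨ v0 , v2 ⟩∈ᶠ v7 ∧ᶠ ∃∈ v6 (⟨ v1 , v0 ⟩∈ᶠ v8 ∧ᶠ v3 ∈ᶠ v0)))

  -- The parameters are `C`, `x`, `k`, `ω` and `bits`, so a slice containing these contains the
  -- result. The digit `l` above `j` ensures that `j` is not the length marker of `m`.
  decode : (C x k : V) → V
  decode C x k = sep decodeᶠ (C ∷ x ∷ k ∷ ω ∷ bits ∷ []) ω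

  ∈decode : j ∈ decode C x k ⇔ (j ∈ ω × ∃ λ i → i ∈ C × i ∉ k × ∃ λ m → m ∈ ω ×
    Token i x m × Bit m j × ∃ λ l → l ∈ ω × Bit m l × j ∈ l)
  ∈decode = ∈sep decodeᶠ

  module Filter {G N W : V} (isFilter : IsFilter P R G) (ω⊆W : ω ⊆ W)
                (meets : ∀ {a} → a ∈ W → ∃ λ p → p ∈ densePart N a × p ∈ G) where

    open IsFilter isFilter using (directed)

    genericᶠ : BFormula 5
    genericᶠ = ∃∈ v1 (∃∈ v3 (∃∈ v5 (v2 ≡⟨ v1 , v0 ⟩ᶠ ∧ᶠ ⟨ v1 , v3 ⟩∈ᶠ v7)))

    generic : V
    generic = sep genericᶠ (G ∷ ω ∷ 𝔽 ∷ bits ∷ []) ω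

    ∈generic : i ∈ generic ⇔ (i ∈ ω × ∃ λ p → p ∈ G × ∃ λ k → k ∈ ω × ∃ λ F → F ∈ 𝔽 ×
                              p ≡ ⟨ k , F ⟩ × Bit k i)
    ∈generic = ∈sep genericᶠ

    generic⊆ω : generic ⊆ ω
    generic⊆ω = proj₁ ∘ to ∈generic

    meet-below : ⟨ k , F ⟩ ∈ G → ⟨ m , D ⟩ ∈ G → ∃ λ j → ∃ λ E → ⟨ j , E ⟩ ∈ G ×
                 ⟨ j , E ⟩ ≤P ⟨ k , F ⟩ × ⟨ j , E ⟩ ≤P ⟨ m , D ⟩
    meet-below p q with directed _ _ p q
    ... | r , r∈ , h , h′ with to ∈P (proj₁ (≤P-∈P (to related h)))
    ... | j , _ , E , _ , refl = j , E , r∈ , to related h , to related h′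

    long-below : ⟨ k , F ⟩ ∈ G → j ∈ ω → ∃ λ m → ∃ λ E → ⟨ m , E ⟩ ∈ G × j ∈ m ×
                 ⟨ m , E ⟩ ≤P ⟨ k , F ⟩
    long-below p j∈ with meets (ω⊆W j∈)
    ... | q , q∈D , q∈G with to ∈densePart q∈D
    ... | _ , n , n∈ , D , D∈ , refl , _ , j<n with meet-below p q∈G
    ... | m , E , r , h , h′ with to ∈R h′
    ... | m∈ , _ , _ , _ , _ , inj₁ refl          = m , E , r , j<n j∈ , h
    ... | m∈ , _ , _ , _ , _ , inj₂ (n<m , _) =
      m , E , r , ∈-nat-trans m∈ (j<n j∈) n<m , h

    -- Conditions of the filter below ⟨k, F⟩ keep its promises about `x`: `Safe` shows that only
    -- elements of `y` are decoded, `Hit` that all of them are.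
    decode-generic : ⟨ k , F ⟩ ∈ G → k ∈ ω → x ∈ F → ⟨ x , y ⟩ ∈ Y →
                     decode generic x k ≡ y
    decode-generic {k} {F} {x} {y} kF∈ k∈ x∈ xy = ext ⊆y y⊆
      where
        ⊆y : decode generic x k ⊆ y
        ⊆y {j} p with to ∈decode p
        ... | j∈ , i , i∈ , i≮k , m , m∈ , t , bj , n , n∈ , bn , j<n with to ∈generic i∈
        ... | i∈ω , _ , q , s , _ , D , _ , refl , bit with meet-below kF∈ q
        ... | r , E , _ , h , h′ with to ∈R h | to ∈R h′
        ... | r∈ , _ , _ , _ , _ , e | _ , _ , _ , _ , _ , e′ = conclude e
          where
            bit-r : Bit r i
            bit-r = bit-up e′
              where
                bit-up : r ≡ s ⊎ Longer r s D → Bit r i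
                bit-up (inj₁ refl)        = bit
                bit-up (inj₂ (_ , c , _)) = from (c i (bit-< bit)) bit
            conclude : r ≡ k ⊎ Longer r k F → j ∈ y
            conclude (inj₁ refl) = ⊥-elim (i≮k (bit-< bit-r))
            conclude (inj₂ (_ , _ , promise))
              with proj₁ (promise x x∈) i i∈ω bit-r i≮k m m∈ t
            ... | l , l∈ , y′ , _ , xy′ , u with functional xy xy′
            ... | refl with to (u j j∈) bj
            ... | inj₁ (_ , j∈y) = j∈y
            -- Here `j` would be the marker of `m`, its greatest digit, but the digit `n` lies above
            -- it.
            ... | inj₂ refl with to (u n n∈) bn
            ... | inj₁ (n<l , _) = ⊥-elim (∈-asym j<n n<l)
            ... | inj₂ refl      = ⊥-elim (∈-irrefl j<n)
        y⊆ : y ⊆ decode generic x k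
        -- Two conditions are taken below: the first has a level beyond `j`, the second extends it
        -- strictly, and the hit between them yields a restriction of `y` longer than `m`, which
        -- therefore decides `j`.
        y⊆ {j} j∈y with long-below kF∈ j∈
          where
            j∈ : j ∈ ω
            j∈ = to ∈𝒫 (proj₂ (to ⟨⟩∈⊗ (⊆⊗ xy))) j∈y
        ... | m , E , mE∈ , j<m , h with to ∈R h
        ... | m∈ , _ , _ , _ , F⊆E , e with long-below mE∈ m∈
        ... | m′ , E′ , mE′∈ , m<m′ , h′ with to ∈R h′
        ... | _ , _ , _ , _ , _ , inj₁ refl = ⊥-elim (∈-irrefl m<m′)
        ... | m′∈ , E′∈ , _ , _ , _ , inj₂ (_ , _ , promise)
          with proj₂ (promise x (F⊆E x x∈))
        ... | i , i∈ , bit , i≮m , n , n∈ , t , l , l∈ , m<l , y′ , _ , xy′ , u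
          with functional xy xy′
        ... | refl = from ∈decode (j∈ω , i ,
            from ∈generic (i∈ , _ , mE′∈ , m′ , m′∈ , E′ , E′∈ , refl , bit) ,
            (λ i<k → i≮m (k⊆m i<k)) , n , n∈ , t ,
            from (u j j∈ω) (inj₁ (j<l , j∈y)) , l , l∈ , token-bit l∈ u , j<l)
          where
            j<l : j ∈ l
            j<l = ∈-nat-trans l∈ j<m m<l
            j∈ω : j ∈ ω
            j∈ω = ω-transitive _ l∈ j<l
            k⊆m : k ⊆ m
            k⊆m {i} = up e
              where
                up : m ≡ k ⊎ Longer m k F → i ∈ k → i ∈ m
                up (inj₁ refl) p     = p
                up (inj₂ (q , _)) p = ∈-nat-trans m∈ p q

-- Renaming of variables

rename : ∀ {m n} → (Fin m → Fin n) → Formula m → Formula n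
lift : ∀ {m n} → (Fin m → Fin n) → Fin (ℕ.suc m) → Fin (ℕ.suc n)
lift σ zero    = zero
lift σ (suc i) = suc (σ i)

rename σ (i ∊ j)  = σ i ∊ σ j
rename σ (i ≐ j)  = σ i ≐ σ j
rename σ (¬′ φ)   = ¬′ rename σ φ
rename σ (φ ∧′ ψ) = rename σ φ ∧′ rename σ ψ
rename σ (φ ∨′ ψ) = rename σ φ ∨′ rename σ ψ
rename σ (φ ⇒′ ψ) = rename σ φ ⇒′ rename σ ψ
rename σ (φ ⇔′ ψ) = rename σ φ ⇔′ rename σ ψ
rename σ (∀′ φ)   = ∀′ rename (lift σ) φ
rename σ (∃′ φ)   = ∃′ rename (lift σ) φ

-- The slices and their subsets of ω

module Slicing {ℓ : Level} (em : ExcludedMiddle ℓ) (𝓥 : Structure ℓ)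
               (zfc : SetTheory.ZFC 𝓥) (slice : SetTheory.Slice 𝓥) where

  open Structure 𝓥 renaming (Carrier to V)
  open SetTheory 𝓥
  open Bits em 𝓥 zfc public
  open U.IsZFC zfc using (separation)
  private module S = Slice slice
  open S using (ω₁; isOmega₁; #params; params) public

  private variable
    a b i j k r x y z α β : V

  Sat-rename : ∀ {m n} (σ : Fin m → Fin n) (φ : Formula m) {ρ : Vec V m} {ρ′ : Vec V n} →
               (∀ i → lookup ρ′ (σ i) ≡ lookup ρ i) → U.Sat (rename σ φ) ρ′ ⇔ U.Sat φ ρ
  Sat-rename σ (i ∊ j) h rewrite h i | h j = ⇔-id _
  Sat-rename σ (i ≐ j) h rewrite h i | h j = ⇔-id _
  Sat-rename σ (¬′ φ) h = ⇔-fn (Sat-rename σ φ h) (⇔-id _)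
  Sat-rename σ (φ ∧′ ψ) h = mk⇔
    (λ (p , q) → to (Sat-rename σ φ h) p , to (Sat-rename σ ψ h) q)
    (λ (p , q) → from (Sat-rename σ φ h) p , from (Sat-rename σ ψ h) q)
  Sat-rename σ (φ ∨′ ψ) h = mk⇔
    (Sum.map (to (Sat-rename σ φ h)) (to (Sat-rename σ ψ h)))
    (Sum.map (from (Sat-rename σ φ h)) (from (Sat-rename σ ψ h)))
  Sat-rename σ (φ ⇒′ ψ) h = ⇔-fn (Sat-rename σ φ h) (Sat-rename σ ψ h)
  Sat-rename σ (φ ⇔′ ψ) h = mk⇔
    (λ e → Sat-rename σ ψ h ⇔-∘ (e ⇔-∘ ⇔-sym (Sat-rename σ φ h)))
    (λ e → ⇔-sym (Sat-rename σ ψ h) ⇔-∘ (e ⇔-∘ Sat-rename σ φ h))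
  Sat-rename σ (∀′ φ) h = mk⇔
    (λ f x _ → to (Sat-rename (lift σ) φ λ { zero → refl ; (suc i) → h i }) (f x _))
    (λ f x _ → from (Sat-rename (lift σ) φ λ { zero → refl ; (suc i) → h i }) (f x _))
  Sat-rename σ (∃′ φ) h = mk⇔
    (λ (x , _ , p) → x , _ , to (Sat-rename (lift σ) φ λ { zero → refl ; (suc i) → h i }) p)
    (λ (x , _ , p) → x , _ , from (Sat-rename (lift σ) φ λ { zero → refl ; (suc i) → h i }) p)

  -- Makes room for the candidate pair, which separation places between the quantified α, x and the
  -- parameters.
  skip : ∀ {n} → Fin (2 ℕ.+ n) → Fin (3 ℕ.+ n)
  skip v0            = v0
  skip v1            = v1
  skip (suc (suc i)) = suc (suc (suc i))

  abstract
    -- The slicing formula can be unbounded, so full separation is used here. From now on, whether a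
    -- subset of ω lies in a slice is an atomic bounded statement about `members`.
    members : V
    members = proj₁ (separation (∃′ ∃′ (opairᶠ v2 v0 v1 ∧′ rename skip S.φ))
                                params (allᵁ params) (ω₁ ⊗ 𝒫 ω) _)

    ∈members : α ∈ ω₁ → x ∈ 𝒫 ω → ⟨ α , x ⟩ ∈ members ⇔ S.M α x
    ∈members {α} {x} α∈ x∈ = mk⇔ f g
      where
        h : z ∈ members ⇔ (z ∈ ω₁ ⊗ 𝒫 ω ×
              U.Sat (∃′ ∃′ (opairᶠ v2 v0 v1 ∧′ rename skip S.φ)) (z ∷ params))
        h {z} = proj₂ (proj₂ (separation (∃′ ∃′ (opairᶠ v2 v0 v1 ∧′ rename skip S.φ))
                                         params (allᵁ params) (ω₁ ⊗ 𝒫 ω) _)) z _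
        skipped : U.Sat (rename skip S.φ) (α ∷ x ∷ z ∷ params) ⇔ S.M α x
        skipped = Sat-rename skip S.φ λ { v0 → refl ; v1 → refl ; (suc (suc i)) → refl }
        f : ⟨ α , x ⟩ ∈ members → S.M α x
        f p with to h p
        ... | _ , _ , _ , _ , _ , e , s with ⟨⟩-injective (to opair e)
        ... | refl , refl = to skipped s
        g : S.M α x → ⟨ α , x ⟩ ∈ members
        g m = from h (from ⟨⟩∈⊗ (α∈ , x∈) , x , _ , α , _ , from opair refl , from skipped m)

  injection⁺ : r ⊆ a ⊗ b → (∀ {x} → x ∈ a → ∃ λ y → ⟨ x , y ⟩ ∈ r) →
    (∀ {x y z} → ⟨ x , y ⟩ ∈ r → ⟨ x , z ⟩ ∈ r → y ≡ z) →
    (∀ {x y z} → ⟨ x , z ⟩ ∈ r → ⟨ y , z ⟩ ∈ r → x ≡ y) → U.IsInjection r a b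
  injection⁺ h t s i = function⁺ h t s , λ _ _ _ _ _ _ p q → i (to related p) (to related q)

  ⊆ω-countable : a ⊆ ω → U.Countable a
  ⊆ω-countable {a} a⊆ω = ω , _ , ω-isOmega , graph φ [] a ω , _ , injection⁺ (graph⊆⊗ φ)
      (λ p → _ , from (∈graph φ) (p , a⊆ω p , refl))
      (λ p q → trans (eq p) (sym (eq q))) (λ p q → trans (sym (eq p)) (eq q))
    where
      φ : BFormula 5
      φ = v0 ≡ᶠ v1
      eq : ⟨ x , y ⟩ ∈ graph φ [] a ω → y ≡ x
      eq p = proj₂ (proj₂ (to (∈graph φ) p))

  -- The injection is shifted by one, which frees 0 for `a`.
  ⁺-countable : U.Countable a → U.Countable (a ⁺)
  ⁺-countable {a} (w , _ , isω , g , _ , (rel , tot , fun) , inj) with isOmega-unique isω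
  ... | refl = ω , _ , ω-isOmega , h , _ , injection⁺ (graph⊆⊗ φ) total functional injective
    where
      φ : BFormula 8
      φ = v1 ≡ᶠ v5 ∧ᶠ v0 ≡ᶠ v6 ∨ᶠ ∃∈ v4 (⟨ v2 , v0 ⟩∈ᶠ v8 ∧ᶠ v1 ≡ v0 ⁺ᶠ)
      h : V
      h = graph φ (a ∷ ∅ ∷ g ∷ []) (a ⁺) ω
      case-h : ⟨ x , j ⟩ ∈ h → x ≡ a × j ≡ ∅ ⊎ ∃ λ i → i ∈ ω × ⟨ x , i ⟩ ∈ g × j ≡ i ⁺
      case-h p = proj₂ (proj₂ (to (∈graph φ) p))
      g-dom : ⟨ x , i ⟩ ∈ g → x ∈ a × i ∈ ω
      g-dom p = to ⟨⟩∈⊗ (relation⁻ rel p)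
      a∉dom : ¬ ⟨ a , i ⟩ ∈ g
      a∉dom p = ∈-irrefl (proj₁ (g-dom p))
      ∅≢⁺ : ¬ ∅ ≡ i ⁺
      ∅≢⁺ e = ∉∅ (subst (_ ∈_) (sym e) self∈⁺)
      total : x ∈ a ⁺ → ∃ λ y → ⟨ x , y ⟩ ∈ h
      total p with to ∈⁺ p
      ... | inj₂ refl = ∅ , from (∈graph φ) (p , ∅∈ω , inj₁ (refl , refl))
      ... | inj₁ q with tot _ _ q
      ... | i , _ , s = i ⁺ , from (∈graph φ) (p , ⁺∈ω i∈ , inj₂ (i , i∈ , to related s , refl))
        where i∈ = proj₂ (g-dom (to related s))
      functional : ⟨ x , y ⟩ ∈ h → ⟨ x , z ⟩ ∈ h → y ≡ z
      functional p q with case-h p | case-h q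
      ... | inj₁ (_ , refl)        | inj₁ (_ , refl)        = refl
      ... | inj₁ (refl , _)        | inj₂ (_ , _ , s , _)   = ⊥-elim (a∉dom s)
      ... | inj₂ (_ , _ , s , _)   | inj₁ (refl , _)        = ⊥-elim (a∉dom s)
      ... | inj₂ (_ , _ , s , e)   | inj₂ (_ , _ , t , e′)  =
        trans e (trans (cong _⁺ (fun _ _ _ _ _ _ (from related s) (from related t))) (sym e′))
      injective : ⟨ x , z ⟩ ∈ h → ⟨ y , z ⟩ ∈ h → x ≡ y
      injective p q with case-h p | case-h q
      ... | inj₁ (refl , _)        | inj₁ (refl , _)        = refl
      ... | inj₁ (_ , e)           | inj₂ (_ , _ , _ , e′)  = ⊥-elim (∅≢⁺ (trans (sym e) e′))
      ... | inj₂ (_ , _ , _ , e)   | inj₁ (_ , e′)          = ⊥-elim (∅≢⁺ (trans (sym e′) e))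
      ... | inj₂ (_ , _ , s , e)   | inj₂ (_ , _ , t , e′)
        with ⁺-injective (trans (sym e) e′)
      ... | refl = inj _ _ _ _ _ _ (from related s) (from related t)

  ω₁-ord : Ord ω₁
  ω₁-ord = ord⁻ (proj₁ isOmega₁)

  ω₁-uncountable : ¬ U.Countable ω₁
  ω₁-uncountable = proj₁ (proj₂ isOmega₁)

  abstract
    ω∈ω₁ : ω ∈ ω₁
    ω∈ω₁ with compare ω-ord ω₁-ord
    ... | inj₁ p        = p
    ... | inj₂ (inj₁ e) = ⊥-elim (ω₁-uncountable (⊆ω-countable λ p → subst (_ ∈_) (sym e) p))
    ... | inj₂ (inj₂ p) = ⊥-elim (ω₁-uncountable (⊆ω-countable (ω-transitive _ p)))

    ω⊆ω₁ : ω ⊆ ω₁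
    ω⊆ω₁ = proj₁ ω₁-ord ω ω∈ω₁

    ⁺∈ω₁ : α ∈ ω₁ → α ⁺ ∈ ω₁
    ⁺∈ω₁ {α} α∈ with compare (Ord-⁺ (Ord-∈ ω₁-ord α∈)) ω₁-ord
    ... | inj₁ p        = p
    ... | inj₂ (inj₁ e) = ⊥-elim (ω₁-uncountable (subst U.Countable e
                            (⁺-countable (proj₂ (proj₂ isOmega₁) α _ α∈))))
    ... | inj₂ (inj₂ p) with to ∈⁺ p
    ... | inj₁ q    = ⊥-elim (∈-asym q α∈)
    ... | inj₂ refl = ⊥-elim (∈-irrefl α∈)

  one two : V
  one = ∅ ⁺
  two = one ⁺

  ∅≢one : ¬ ∅ ≡ one
  ∅≢one e = ∉∅ (subst (∅ ∈_) (sym e) self∈⁺)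

  ∅∈two : ∅ ∈ two
  ∅∈two = ⊆⁺ self∈⁺

  ∈two : x ∈ two → x ≡ ∅ ⊎ x ≡ one
  ∈two p with to ∈⁺ p
  ... | inj₂ e = inj₂ e
  ... | inj₁ q with to ∈⁺ q
  ... | inj₁ s = ⊥-elim (∉∅ s)
  ... | inj₂ e = inj₁ e

  one∈ω : one ∈ ω
  one∈ω = ⁺∈ω ∅∈ω

  isTwo : U.IsTwo two
  isTwo = ∅ , _ , one , _ , (λ _ _ → ∉∅) , succ , succ
    where
      succ : U.IsSuccessor (x ⁺) x
      succ = from (UA.successor-absolute _ _) refl

  isTwo-unique : U.IsTwo x → x ≡ two
  isTwo-unique (e , _ , s , _ , empty , p , q)
    with ext {e} {∅} (λ z∈ → ⊥-elim (empty _ _ z∈)) (λ z∈ → ⊥-elim (∉∅ z∈))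
  ... | refl with to (UA.successor-absolute _ _) p
  ... | refl = to (UA.successor-absolute _ _) q

  χᶠ : BFormula 8
  χᶠ = v1 ∈ᶠ v5 ∧ᶠ v0 ≡ᶠ v6 ∨ᶠ ¬ᶠ v1 ∈ᶠ v5 ∧ᶠ v0 ≡ᶠ v7

  -- The slicing speaks of functions from ω to 2, the order of subsets of ω. `χ` and `support`
  -- translate, and being boundedly definable they preserve every slice.
  χ : V → V
  χ x = graph χᶠ (x ∷ one ∷ ∅ ∷ []) ω two

  supportᶠ : BFormula 3
  supportᶠ = ⟨ v0 , v1 ⟩∈ᶠ v2

  support : V → V
  support r = sep supportᶠ (one ∷ r ∷ []) ω

  ∈support : k ∈ support r ⇔ (k ∈ ω × ⟨ k , one ⟩ ∈ r)
  ∈support = ∈sep supportᶠ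

  ∈χ : ⟨ k , i ⟩ ∈ χ x ⇔ (k ∈ ω × i ∈ two × (k ∈ x × i ≡ one ⊎ k ∉ x × i ≡ ∅))
  ∈χ = ∈graph χᶠ

  χ-isReal : ∀ x → U.IsReal (χ x)
  χ-isReal x = ω , _ , two , _ , ω-isOmega , isTwo , function⁺ (graph⊆⊗ χᶠ) total functional
    where
      total : k ∈ ω → ∃ λ i → ⟨ k , i ⟩ ∈ χ x
      total {k} k∈ with em {k ∈ x}
      ... | yes p = one , from ∈χ (k∈ , self∈⁺ , inj₁ (p , refl))
      ... | no p  = ∅ , from ∈χ (k∈ , ∅∈two , inj₂ (p , refl))
      functional : ⟨ k , i ⟩ ∈ χ x → ⟨ k , j ⟩ ∈ χ x → i ≡ j
      functional p q with to ∈χ p | to ∈χ q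
      ... | _ , _ , inj₁ (_ , refl) | _ , _ , inj₁ (_ , refl) = refl
      ... | _ , _ , inj₂ (_ , refl) | _ , _ , inj₂ (_ , refl) = refl
      ... | _ , _ , inj₁ (s , _)    | _ , _ , inj₂ (t , _)    = ⊥-elim (t s)
      ... | _ , _ , inj₂ (s , _)    | _ , _ , inj₁ (t , _)    = ⊥-elim (s t)

  support-χ : x ∈ 𝒫 ω → support (χ x) ≡ x
  support-χ {x} x∈ = ext f (λ p → from ∈support (to ∈𝒫 x∈ p ,
      from ∈χ (to ∈𝒫 x∈ p , self∈⁺ , inj₁ (p , refl))))
    where
      f : support (χ x) ⊆ x
      f p with to ∈χ (proj₂ (to ∈support p))
      ... | _ , _ , inj₁ (q , _) = q
      ... | _ , _ , inj₂ (_ , e) = ⊥-elim (∅≢one (sym e))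

  χ-support : U.IsReal r → χ (support r) ≡ r
  χ-support {r} (w , _ , t , _ , isω , is2 , rel , tot , fun)
    with isOmega-unique isω | isTwo-unique is2
  ... | refl | refl = ext f g
    where
      f : χ (support r) ⊆ r
      f p with to ∈⊗ (graph⊆⊗ χᶠ p)
      ... | k , k∈ , i , i∈ , refl with to ∈χ p
      ... | _ , _ , inj₁ (q , refl) = proj₂ (to ∈support q)
      ... | _ , _ , inj₂ (q , refl) with tot _ _ k∈
      ... | j , _ , s with ∈two (proj₂ (to ⟨⟩∈⊗ (relation⁻ rel (to related s))))
      ... | inj₁ refl = to related s
      ... | inj₂ refl = ⊥-elim (q (from ∈support (k∈ , to related s)))
      g : r ⊆ χ (support r)
      g p with to ∈⊗ (relation⁻ rel p)
      ... | k , k∈ , i , i∈ , refl with ∈two i∈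
      ... | inj₂ refl = from ∈χ (k∈ , i∈ , inj₁ (from ∈support (k∈ , p) , refl))
      ... | inj₁ refl = from ∈χ (k∈ , i∈ , inj₂ (k∉ , refl))
        where
          k∉ : k ∉ support r
          k∉ q = ∅≢one (fun _ _ _ _ _ _ (from related p) (from related (proj₂ (to ∈support q))))

  M-transitive : α ∈ ω₁ → S.M α x → y ∈ x → S.M α y
  M-transitive α∈ = S.transitive _ α∈ _ _

  M-ω : α ∈ ω₁ → S.M α ω
  M-ω α∈ = M-transitive α∈ (proj₁ (S.ω₁-correct _ α∈)) ω∈ω₁

  module ModelAt {α : V} (α∈ : α ∈ ω₁) = Model {S.M α} (M-transitive α∈) (S.zfc α α∈)

  abstract
    -- The counter built inside the slice and the true one both satisfy `IsBits`, hence coincide.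
    M-bits : α ∈ ω₁ → S.M α bits
    M-bits {α} α∈ = subst (S.M α)
        (ext (bits-⊆ B.bits-isBits bits-isBits) (bits-⊆ bits-isBits B.bits-isBits)) B.M-bits
      where module B = BitsIn {S.M α} (M-transitive α∈) (S.zfc α α∈) (M-ω α∈)

  M-nat : α ∈ ω₁ → k ∈ ω → S.M α k
  M-nat α∈ = M-transitive α∈ (M-ω α∈)

  M-χ : α ∈ ω₁ → S.M α x → S.M α (χ x)
  M-χ α∈ m = ModelAt.graph-closed α∈ χᶠ
    (m ∷ M-nat α∈ one∈ω ∷ M-nat α∈ ∅∈ω ∷ []) (M-ω α∈) (M-nat α∈ (⁺∈ω one∈ω))

  M-support : α ∈ ω₁ → S.M α r → S.M α (support r)
  M-support α∈ m = ModelAt.sep-closed α∈ supportᶠ (M-nat α∈ one∈ω ∷ m ∷ []) (M-ω α∈)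

  abstract
    covered : x ∈ 𝒫 ω → ∃ λ α → α ∈ ω₁ × S.M α x
    covered {x} x∈ with S.covers (χ x) (χ-isReal x)
    ... | α , α∈ , m = α , α∈ , subst (S.M α) (support-χ x∈) (M-support α∈ m)

    increasing : x ∈ 𝒫 ω → α ∈ β → β ∈ ω₁ → S.M α x → S.M β x
    increasing {x} {α} {β} x∈ α<β β∈ m = subst (S.M β) (support-χ x∈)
      (M-support β∈ (S.increasing α β α<β β∈ (χ x) (χ-isReal x)
        (M-χ (proj₁ ω₁-ord β β∈ α<β) m)))

    -- Strictness is applied between α and its successor, again an index since `ω₁` is closed under
    -- successors.
    omitted : α ∈ ω₁ → ∃ λ x → x ∈ 𝒫 ω × ¬ S.M α x
    omitted {α} α∈ with S.strict α (α ⁺) self∈⁺ (⁺∈ω₁ α∈)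
    ... | r , real , _ , r∉ = support r , from ∈𝒫 (proj₁ ∘ to ∈support) ,
      λ m → r∉ (subst (S.M α) (χ-support real) (M-χ α∈ m))

-- The choice of `Y` and the contradiction

module Contradiction {ℓ : Level} (em : ExcludedMiddle ℓ) (𝓥 : Structure ℓ)
                     (zfc : SetTheory.ZFC 𝓥) (slice : SetTheory.Slice 𝓥)
                     (ma : SetTheory.MA-ω₁-σ-centred 𝓥) where

  open Structure 𝓥 renaming (Carrier to V)
  open SetTheory 𝓥
  open Slicing em 𝓥 zfc slice
  private
    module S = Slice slice
    module F = Forcing em 𝓥 zfc

  private variable
    k x y α β : V

  escapesᶠ : BFormula 7
  escapesᶠ = ∃∈ v5 (⟨ v0 , v2 ⟩∈ᶠ v7 ∧ᶠ ¬ᶠ ⟨ v0 , v1 ⟩∈ᶠ v7)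

  abstract
    escapes : V
    escapes = graph escapesᶠ (ω₁ ∷ members ∷ []) (𝒫 ω) (𝒫 ω)

    escapes⊆⊗ : escapes ⊆ 𝒫 ω ⊗ 𝒫 ω
    escapes⊆⊗ = graph⊆⊗ escapesᶠ

    ∈escapes : ⟨ x , y ⟩ ∈ escapes ⇔ (x ∈ 𝒫 ω × y ∈ 𝒫 ω ×
      ∃ λ γ → γ ∈ ω₁ × ⟨ γ , x ⟩ ∈ members × ¬ ⟨ γ , y ⟩ ∈ members)
    ∈escapes = ∈graph escapesᶠ

  escape-exists : x ∈ 𝒫 ω → ∃ λ y → ⟨ x , y ⟩ ∈ escapes
  escape-exists x∈ with covered x∈
  ... | α , α∈ , m with omitted α∈
  ... | y , y∈ , ¬m = y , from ∈escapes
    (x∈ , y∈ , α , α∈ , from (∈members α∈ x∈) m , ¬m ∘ to (∈members α∈ y∈))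

  abstract
    escape-map : ∃ λ Y → Y ⊆ escapes × F.IsRealMap Y
    escape-map = let (Y , Y⊆ , tot , fun) = uniformize escapes⊆⊗ in
      Y , Y⊆ , record
        { ⊆⊗ = λ p → escapes⊆⊗ (Y⊆ p)
        ; total = λ x∈ → tot (proj₂ (escape-exists x∈))
        ; functional = fun
        }

  Y : V
  Y = proj₁ escape-map

  Y-map : F.IsRealMap Y
  Y-map = proj₂ (proj₂ escape-map)

  Y-escapes : ⟨ x , y ⟩ ∈ Y → x ∈ 𝒫 ω × y ∈ 𝒫 ω × ∃ λ γ → γ ∈ ω₁ × S.M γ x × ¬ S.M γ y
  Y-escapes p with to ∈escapes (proj₁ (proj₂ escape-map) p)
  ... | x∈ , y∈ , γ , γ∈ , m , ¬m =
    x∈ , y∈ , γ , γ∈ , to (∈members γ∈ x∈) m , ¬m ∘ from (∈members γ∈ y∈)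

  module G = Generic em 𝓥 zfc Y Y-map

  dense : α ∈ ω₁ → IsDense G.P G.R (G.densePart members α)
  dense α∈ with omitted α∈
  ... | x , x∈ , ¬m = G.densePart-dense (x , x∈ , ¬m ∘ to (∈members α∈ x∈))

  filter : ∃ λ H → IsFilter G.P G.R H ×
           (∀ {α} → α ∈ ω₁ → ∃ λ p → p ∈ G.densePart members α × p ∈ H)
  filter with G.denseParts-function members ω₁
  ... | d , isFun , ∈d with ma G.P G.R G.isPartialOrder G.isσCentred ω₁ (𝒫 G.P) d isOmega₁ isFun
      (λ α D r → let (α∈ , e) = to ∈d (to related r) in
                 subst (IsDense G.P G.R) (sym e) (dense α∈))
  ... | H , isFilter , meets = H , isFilter ,
    λ α∈ → meets _ _ (from related (from ∈d (α∈ , refl)))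

  open G.Filter {W = ω₁} (proj₁ (proj₂ filter)) ω⊆ω₁ (proj₂ (proj₂ filter))
    using (generic; generic⊆ω; decode-generic)

  first-appearance : α ∈ ω₁ → β ∈ ω₁ → x ∈ 𝒫 ω → ¬ S.M α x → S.M β x → α ∈ β
  first-appearance {α} {β} α∈ β∈ x∈ ¬mα mβ =
      earlier (compare (Ord-∈ ω₁-ord α∈) (Ord-∈ ω₁-ord β∈))
    where
      earlier : Comparable α β → α ∈ β
      earlier (inj₁ q)           = q
      earlier (inj₂ (inj₁ refl)) = ⊥-elim (¬mα mβ)
      earlier (inj₂ (inj₂ q))    = ⊥-elim (¬mα (increasing x∈ q α∈ mβ))

  generic∉M : α ∈ ω₁ → ¬ S.M α generic
  generic∉M {α} α∈ mα =
    let (p , p∈ , p∈H) = proj₂ (proj₂ filter) α∈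
        (_ , k , k∈ , E , E∈ , p≡ , (x , x∈E , αx∉) , _) = to G.∈densePart p∈
        (y , xy) = F.IsRealMap.total Y-map (F.𝔽-real E∈ x∈E)
        (x∈ , y∈ , γ , γ∈ , mx , ¬my) = Y-escapes xy
        α<γ = first-appearance α∈ γ∈ x∈ (αx∉ ∘ from (∈members α∈ x∈)) mx
        -- All parameters of the decoding lie in M_γ: the generic set comes up from M_α since α < γ,
        -- and `x` is there by the choice of γ.
        decoded = ModelAt.sep-closed γ∈ G.decodeᶠ
          (increasing (from ∈𝒫 generic⊆ω) α<γ γ∈ mα ∷ mx ∷ M-nat γ∈ k∈ ∷ M-ω γ∈ ∷
           M-bits γ∈ ∷ []) (M-ω γ∈)
    in ¬my (subst (S.M γ) (decode-generic (subst (_∈ proj₁ filter) p≡ p∈H) k∈ x∈E xy) decoded)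

  contradiction : ⊥
  contradiction = let (α , α∈ , mα) = covered (from ∈𝒫 generic⊆ω) in generic∉M α∈ mα

theorem3p1 : ∀ {ℓ} → ExcludedMiddle ℓ → (𝓥 : Structure ℓ) → SetTheory.ZFC 𝓥 → SetTheory.Slice 𝓥 → ¬ SetTheory.MA-ω₁-σ-centred 𝓥
theorem3p1 em 𝓥 zfc slice ma = Contradiction.contradiction em 𝓥 zfc slice ma
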